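{- Let $\widetilde{\mathcal{G}}_{\mathrm{c-m}}$ and $\widetilde{\mathcal{G}}_{\mathrm{c-c}}$ be the subsets of $\widetilde{\mathcal{G}}$ consisting of the functions of cumulant-to-moment type and of cumulant-to-cumulant type, respectively, and let $g_{\mathrm{bc-m}} \in \widetilde{\mathcal{G}}$ be the function which encodes the transition from Boolean cumulants to moments. Then $$ \widetilde{\mathcal{G}}_{\mathrm{c-m}} = \{ g * g_{\mathrm{bc-m}} \mid g \in \widetilde{\mathcal{G}}_{\mathrm{c-c}} \}. $$
   Context: For $n \ge 1$, $NC(n)$ is the set of non-crossing partitions of $\{1,\ldots,n\}$, partially ordered by reverse refinement: $\pi \le \sigma$ iff every block of $\sigma$ is a union of blocks of $\pi$. $1_n \in NC(n)$ is the partition with a single block. Put $NC^{(2)} := \sqcup_{n=1}^{\infty} \{ (\pi,\sigma) \mid \pi,\sigma \in NC(n),\ \pi \le \sigma \}$. For $\pi \in NC(n)$ and a non-empty $W = \{p_1 < \cdots < p_m\} \subseteq \{1,\ldots,n\}$, $\pi_W \in NC(m)$ is the partition for which $i,j$ are in the same block of $\pi_W$ iff $p_i,p_j$ are in the same block of $\pi$. $\widetilde{\mathcal{G}}$ is the set of functions $g : NC^{(2)} \to \mathbb{C}$ such that $g(\pi,\pi)=1$ for all $\pi$ and $g(\pi,\sigma) = \prod_{W \in \sigma} g(\pi_W, 1_{|W|})$ for every $n \ge 1$ and $\pi \le \sigma$ in $NC(n)$. It is a group under convolution, $(f*g)(\pi,\sigma) = \sum_{\rho:\ \pi \le \rho \le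 \sigma} f(\pi,\rho) g(\rho,\sigma)$. A function $g \in \widetilde{\mathcal{G}}$ is uniquely determined by its values $g(\pi,1_n)$, and these values can be prescribed arbitrarily for $\pi \in NC(n)\setminus\{1_n\}$, $n \ge 1$. For $\pi_1 \in NC(n_1)$, $\pi_2 \in NC(n_2)$, the concatenation $\pi_1 \diamond \pi_2 \in NC(n_1+n_2)$ is obtained by placing $\pi_1$ on the points $1,\ldots,n_1$ and $\pi_2$ on the points $n_1+1,\ldots,n_1+n_2$. $g \in \widetilde{\mathcal{G}}$ is of cumulant-to-moment type if $g(\pi_1 \diamond \pi_2, 1_{n_1+n_2}) = g(\pi_1,1_{n_1})\, g(\pi_2,1_{n_2})$ for all $n_1,n_2 \ge 1$, $\pi_1 \in NC(n_1)$, $\pi_2 \in NC(n_2)$; it is of cumulant-to-cumulant type if $g(\pi_1 \diamond \pi_2, 1_{n_1+n_2}) = 0$ for all such $n_1,n_2,\pi_1,\pi_2$. $\mathrm{Int}(n) \subseteq NC(n)$ is the set of interval partitions (all blocks are intervals of $\{1,\ldots,n\}$). $g_{\mathrm{bc-m}}$ is the unique function in $\widetilde{\mathcal{G}}$ such that for all $n \ge 1$ and $\pi \in NC(n)$: $g_{\mathrm{bc-m}}(\pi,1_n) = 1$ if $\pi \in \mathrm{Int}(n)$, and $g_{\mathrm{bc-m}}(\pi,1_n)=0$ otherwise. -}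

module Defs where

open import Algebra.Bundles using (CommutativeRing)
open import Data.Bool.Base using (if_then_else_)
open import Data.Empty using () renaming (⊥ to Empty)
open import Data.Fin.Base using (Fin; zero; suc; _↑ˡ_; _↑ʳ_; splitAt; join)
  renaming (_≤_ to _≤ᶠ_; _<_ to _<ᶠ_)
import Data.Fin.Properties as Fin
open import Data.Fin.Subset using (Subset; inside; outside; _∈_; _⊆_; ⊤; ⊥; ∣_∣)
open import Data.Fin.Subset.Properties using (_∈?_; _⊆?_; ∈⊤; ∉⊥)
open import Data.Irrelevant using ([_])
open import Data.List.Base using (List; []; _∷_; foldr; filter; allFin; cartesianProductWith)
open import Data.Nat.Base using (ℕ; zero; suc; _+_; NonZero; s≤s; z≤n)
import Data.Nat.Properties as ℕ
open import Data.Product.Base using (_×_; _,_; proj₁; proj₂)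
open import Data.Refinement using (Refinement; Refinement-syntax; value) renaming (_,_ to _,ʳ_)
open import Data.Sum.Base using (_⊎_; inj₁; inj₂)
open import Data.Unit.Base using () renaming (⊤ to Unit)
open import Data.Vec.Base using (Vec; []; _∷_; _++_; map; lookup; tabulate; replicate; here; there)
open import Function.Bundles using (mk⇔)
open import Level using (Level)
open import Relation.Binary.PropositionalEquality
  using (_≡_; refl; sym; trans; cong; subst; subst₂)
open import Relation.Binary.Structures using (IsEquivalence)
open import Relation.Nullary using (¬_; Dec; yes; no; does; recompute)
open import Relation.Nullary.Decidable using (map′; _×-dec_; _→-dec_; dec-true; dec-false; does-⇔)
open import Relation.Unary using (Pred; Decidable; _∩_)

private
  variable
    a p : Level
    A : Set a
    P : A → Set p
    m n n₁ n₂ : ℕ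

-- A partition of {1,…,n} is stored as the vector whose i-th entry is the
-- block containing i.  This form is canonical, and the proof that it is a
-- non-crossing partition is irrelevant, so _≡_ on NC n is equality of
-- partitions.

record IsNonCrossing (B : Vec (Subset n) n) : Set where
  field
    isEquivalence : IsEquivalence (λ i j → j ∈ lookup B i)
    nonCrossing   : ∀ {a b c d} → a <ᶠ b → b <ᶠ c → c <ᶠ d →
                    c ∈ lookup B a → d ∈ lookup B b → b ∈ lookup B a

isNonCrossing? : Decidable (IsNonCrossing {n})
isNonCrossing? B = map′
  (λ (r , s , t , x) → record
    { isEquivalence = record
      { refl = λ {i} → r i ; sym = λ {i} {j} → s i j ; trans = λ {i} {j} {k} → t i j k }
    ; nonCrossing = λ {a} {b} {c} {d} → x a b c d })
  (λ nc → let open IsNonCrossing nc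
              open IsEquivalence isEquivalence renaming (refl to r; sym to s; trans to t)
          in (λ _ → r) , (λ _ _ → s) , (λ _ _ _ → t) , (λ _ _ _ _ → nonCrossing))
  (Fin.all? (λ i → i ∈? lookup B i)
   ×-dec Fin.all? (λ i → Fin.all? λ j → j ∈? lookup B i →-dec i ∈? lookup B j)
   ×-dec Fin.all? (λ i → Fin.all? λ j → Fin.all? λ k →
           j ∈? lookup B i →-dec k ∈? lookup B j →-dec k ∈? lookup B i)
   ×-dec Fin.all? (λ a → Fin.all? λ b → Fin.all? λ c → Fin.all? λ d →
           a Fin.<? b →-dec b Fin.<? c →-dec c Fin.<? d →-dec
           c ∈? lookup B a →-dec d ∈? lookup B b →-dec b ∈? lookup B a))

NC : ℕ → Set
NC n = [ B ∈ Vec (Subset n) n ∣ IsNonCrossing B ]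

block : NC n → Fin n → Subset n
block π = lookup (value π)

isNonCrossing : (π : NC n) → IsNonCrossing (value π)
isNonCrossing (B ,ʳ [ nc ]) = recompute (isNonCrossing? B) nc

module _ (π : NC n) where
  open IsNonCrossing (isNonCrossing π) public using (nonCrossing)
  open IsEquivalence (IsNonCrossing.isEquivalence (isNonCrossing π)) public
    renaming (refl to ∼-refl; sym to ∼-sym; trans to ∼-trans) using ()

-- Each block listed once, through its least element.
IsLeast : NC n → Fin n → Set
IsLeast σ i = ∀ j → j ∈ block σ i → i ≤ᶠ j

isLeast? : (σ : NC n) → Decidable (IsLeast σ)
isLeast? σ i = Fin.all? λ j → j ∈? block σ i →-dec i Fin.≤? j

leastElements : NC n → List (Fin n)
leastElements {n} σ = filter (isLeast? σ) (allFin n)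

_IsUnionOfBlocksOf_ : Subset n → NC n → Set
V IsUnionOfBlocksOf π = ∀ i → i ∈ V → block π i ⊆ V

infix 4 _≤_ _≤?_

_≤_ : NC n → NC n → Set
π ≤ σ = ∀ i → block σ i IsUnionOfBlocksOf π

_≤?_ : (π σ : NC n) → Dec (π ≤ σ)
π ≤? σ = Fin.all? λ i → Fin.all? λ j → j ∈? block σ i →-dec block π j ⊆? block σ i

≤-refl : (π : NC n) → π ≤ π
≤-refl π _ _ j∈i k∈j = ∼-trans π j∈i k∈j

lookup-⊤ : (i j : Fin n) → j ∈ lookup (replicate n (⊤ {n})) i
lookup-⊤ {n} i j = subst (j ∈_) (sym (lookup-replicate i ⊤)) ∈⊤
  where open import Data.Vec.Properties using (lookup-replicate)

1ₙ : NC n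
1ₙ {n} = replicate n ⊤ ,ʳ [ record
  { isEquivalence = record
    { refl = lookup-⊤ _ _ ; sym = λ _ → lookup-⊤ _ _ ; trans = λ _ _ → lookup-⊤ _ _ }
  ; nonCrossing = λ _ _ _ _ _ → lookup-⊤ _ _ } ]

≤1ₙ : (π : NC n) → π ≤ 1ₙ
≤1ₙ π _ _ _ _ = lookup-⊤ _ _

-- The increasing enumeration p₁ < ⋯ < pₘ of the elements of a subset.
elements : (W : Subset n) → Fin ∣ W ∣ → Fin n
elements (inside  ∷ W) zero    = zero
elements (inside  ∷ W) (suc i) = suc (elements W i)
elements (outside ∷ W) i       = suc (elements W i)

elements-< : (W : Subset n) {i j : Fin ∣ W ∣} → i <ᶠ j → elements W i <ᶠ elements W j
elements-< (inside  ∷ W) {zero}  {suc j} _         = s≤s z≤n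
elements-< (inside  ∷ W) {suc i} {suc j} (s≤s i<j) = s≤s (elements-< W i<j)
elements-< (outside ∷ W)                 i<j       = s≤s (elements-< W i<j)

-- The trace of V on W, renumbered along elements W.
trace : (W V : Subset n) → Subset ∣ W ∣
trace W V = tabulate λ j → lookup V (elements W j)

module _ where
  open import Data.Vec.Properties using ([]=⇒lookup; lookup⇒[]=; lookup∘tabulate)

  ∈-trace⁺ : (W V : Subset n) {j : Fin ∣ W ∣} → elements W j ∈ V → j ∈ trace W V
  ∈-trace⁺ W V {j} x = lookup⇒[]= j _ (trans (lookup∘tabulate _ j) ([]=⇒lookup x))

  ∈-trace⁻ : (W V : Subset n) {j : Fin ∣ W ∣} → j ∈ trace W V → elements W j ∈ V
  ∈-trace⁻ W V {j} x = lookup⇒[]= _ V (trans (sym (lookup∘tabulate _ j)) ([]=⇒lookup x))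

infixl 8 _↾_

restrictBlocks : Vec (Subset n) n → (W : Subset n) → Vec (Subset ∣ W ∣) ∣ W ∣
restrictBlocks B W = tabulate λ i → trace W (lookup B (elements W i))

module _ (B : Vec (Subset n) n) (W : Subset n) where
  open import Data.Vec.Properties using (lookup∘tabulate)

  ∈-restrict⁺ : ∀ {i j} → elements W j ∈ lookup B (elements W i) →
                j ∈ lookup (restrictBlocks B W) i
  ∈-restrict⁺ {i} x = subst (_ ∈_) (sym (lookup∘tabulate _ i)) (∈-trace⁺ W _ x)

  ∈-restrict⁻ : ∀ {i j} → j ∈ lookup (restrictBlocks B W) i →
                elements W j ∈ lookup B (elements W i)
  ∈-restrict⁻ {i} x = ∈-trace⁻ W _ (subst (_ ∈_) (lookup∘tabulate _ i) x)

_↾_ : NC n → (W : Subset n) → NC ∣ W ∣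
π@(B ,ʳ _) ↾ W = restrictBlocks B W ,ʳ [ record
  { isEquivalence = record
    { refl  = ∈-restrict⁺ B W (∼-refl π)
    ; sym   = λ x → ∈-restrict⁺ B W (∼-sym π (∈-restrict⁻ B W x))
    ; trans = λ x y → ∈-restrict⁺ B W (∼-trans π (∈-restrict⁻ B W x) (∈-restrict⁻ B W y)) }
  ; nonCrossing = λ a<b b<c c<d x y → ∈-restrict⁺ B W
      (nonCrossing π (elements-< W a<b) (elements-< W b<c) (elements-< W c<d)
        (∈-restrict⁻ B W x) (∈-restrict⁻ B W y)) } ]

concatBlocks : Vec (Subset m) m → Vec (Subset n) n → Vec (Subset (m + n)) (m + n)
concatBlocks B₁ B₂ = map (_++ ⊥) B₁ ++ map (⊥ ++_) B₂

module Concat (B₁ : Vec (Subset m) m) (B₂ : Vec (Subset n) n) where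
  open import Data.Vec.Properties
    using ([]=⇒lookup; lookup⇒[]=; lookup-map; lookup-++ˡ; lookup-++ʳ)

  private C = concatBlocks B₁ B₂

  Same : Fin m ⊎ Fin n → Fin m ⊎ Fin n → Set
  Same (inj₁ i) (inj₁ j) = j ∈ lookup B₁ i
  Same (inj₁ i) (inj₂ j) = Empty
  Same (inj₂ i) (inj₁ j) = Empty
  Same (inj₂ i) (inj₂ j) = j ∈ lookup B₂ i

  rowˡ : ∀ i → lookup C (i ↑ˡ n) ≡ lookup B₁ i ++ ⊥
  rowˡ i = trans (lookup-++ˡ (map (_++ ⊥) B₁) _ i) (lookup-map i (_++ ⊥) B₁)

  rowʳ : ∀ i → lookup C (m ↑ʳ i) ≡ ⊥ ++ lookup B₂ i
  rowʳ i = trans (lookup-++ʳ (map (_++ ⊥) B₁) _ i) (lookup-map i (⊥ ++_) B₂)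

  inˡ : (V : Subset m) (U : Subset n) {j : Fin m} → (j ↑ˡ n) ∈ (V ++ U) → j ∈ V
  inˡ V U {j} x = lookup⇒[]= j V (trans (sym (lookup-++ˡ V U j)) ([]=⇒lookup x))

  inʳ : (V : Subset m) (U : Subset n) {j : Fin n} → (m ↑ʳ j) ∈ (V ++ U) → j ∈ U
  inʳ V U {j} x = lookup⇒[]= j U (trans (sym (lookup-++ʳ V U j)) ([]=⇒lookup x))

  ofˡ : (V : Subset m) (U : Subset n) {j : Fin m} → j ∈ V → (j ↑ˡ n) ∈ (V ++ U)
  ofˡ V U {j} x = lookup⇒[]= _ _ (trans (lookup-++ˡ V U j) ([]=⇒lookup x))

  ofʳ : (V : Subset m) (U : Subset n) {j : Fin n} → j ∈ U → (m ↑ʳ j) ∈ (V ++ U)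
  ofʳ V U {j} x = lookup⇒[]= _ _ (trans (lookup-++ʳ V U j) ([]=⇒lookup x))

  ∈-join⁻ : ∀ x y → join m n y ∈ lookup C (join m n x) → Same x y
  ∈-join⁻ (inj₁ i) (inj₁ j) h = inˡ _ ⊥ (subst (_ ∈_) (rowˡ i) h)
  ∈-join⁻ (inj₁ i) (inj₂ j) h = ∉⊥ (inʳ (lookup B₁ i) ⊥ (subst (_ ∈_) (rowˡ i) h))
  ∈-join⁻ (inj₂ i) (inj₁ j) h = ∉⊥ (inˡ ⊥ (lookup B₂ i) (subst (_ ∈_) (rowʳ i) h))
  ∈-join⁻ (inj₂ i) (inj₂ j) h = inʳ ⊥ _ (subst (_ ∈_) (rowʳ i) h)

  ∈-join⁺ : ∀ x y → Same x y → join m n y ∈ lookup C (join m n x)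
  ∈-join⁺ (inj₁ i) (inj₁ j) h = subst (_ ∈_) (sym (rowˡ i)) (ofˡ _ ⊥ h)
  ∈-join⁺ (inj₂ i) (inj₂ j) h = subst (_ ∈_) (sym (rowʳ i)) (ofʳ ⊥ _ h)

  ∈-concat⁻ : ∀ i j → j ∈ lookup C i → Same (splitAt m i) (splitAt m j)
  ∈-concat⁻ i j h = ∈-join⁻ (splitAt m i) (splitAt m j)
    (subst₂ (λ u v → v ∈ lookup C u)
      (sym (Fin.join-splitAt m n i)) (sym (Fin.join-splitAt m n j)) h)

  ∈-concat⁺ : ∀ i j → Same (splitAt m i) (splitAt m j) → j ∈ lookup C i
  ∈-concat⁺ i j h = subst₂ (λ u v → v ∈ lookup C u)
    (Fin.join-splitAt m n i) (Fin.join-splitAt m n j)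
    (∈-join⁺ (splitAt m i) (splitAt m j) h)

  _⊏_ : Fin m ⊎ Fin n → Fin m ⊎ Fin n → Set
  inj₁ i ⊏ inj₁ j = i <ᶠ j
  inj₁ i ⊏ inj₂ j = Unit
  inj₂ i ⊏ inj₁ j = Empty
  inj₂ i ⊏ inj₂ j = i <ᶠ j

  join-⊏ : ∀ x y → join m n x <ᶠ join m n y → x ⊏ y
  join-⊏ (inj₁ i) (inj₁ j) h
    rewrite Fin.toℕ-↑ˡ i n | Fin.toℕ-↑ˡ j n = h
  join-⊏ (inj₁ i) (inj₂ j) h = _
  join-⊏ (inj₂ i) (inj₁ j) h
    rewrite Fin.toℕ-↑ʳ m i | Fin.toℕ-↑ˡ j n =
    ℕ.<-irrefl refl (ℕ.<-trans (ℕ.≤-<-trans (ℕ.m≤m+n m _) h) (Fin.toℕ<n j))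
  join-⊏ (inj₂ i) (inj₂ j) h
    rewrite Fin.toℕ-↑ʳ m i | Fin.toℕ-↑ʳ m j = ℕ.+-cancelˡ-< m _ _ h

  split-⊏ : ∀ i j → i <ᶠ j → splitAt m i ⊏ splitAt m j
  split-⊏ i j h = join-⊏ (splitAt m i) (splitAt m j)
    (subst₂ _<ᶠ_ (sym (Fin.join-splitAt m n i)) (sym (Fin.join-splitAt m n j)) h)

  isNonCrossing-concat : IsNonCrossing B₁ → IsNonCrossing B₂ → IsNonCrossing C
  isNonCrossing-concat nc₁ nc₂ = record
    { isEquivalence = record
      { refl  = λ {i} → ∈-concat⁺ i i (same-refl (splitAt m i))
      ; sym   = λ {i} {j} x → ∈-concat⁺ j i
                  (same-sym (splitAt m i) (splitAt m j) (∈-concat⁻ i j x))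
      ; trans = λ {i} {j} {k} x y → ∈-concat⁺ i k
                  (same-trans (splitAt m i) (splitAt m j) (splitAt m k)
                    (∈-concat⁻ i j x) (∈-concat⁻ j k y)) }
    ; nonCrossing = λ {a} {b} {c} {d} a<b b<c c<d x y → ∈-concat⁺ a b
        (same-nc (splitAt m a) (splitAt m b) (splitAt m c) (splitAt m d)
          (split-⊏ a b a<b) (split-⊏ b c b<c) (split-⊏ c d c<d)
          (∈-concat⁻ a c x) (∈-concat⁻ b d y)) }
    where
    module N₁ = IsNonCrossing nc₁
    module N₂ = IsNonCrossing nc₂
    module E₁ = IsEquivalence N₁.isEquivalence
    module E₂ = IsEquivalence N₂.isEquivalence

    same-refl : ∀ x → Same x x
    same-refl (inj₁ i) = E₁.refl
    same-refl (inj₂ i) = E₂.refl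

    same-sym : ∀ x y → Same x y → Same y x
    same-sym (inj₁ _) (inj₁ _) = E₁.sym
    same-sym (inj₂ _) (inj₂ _) = E₂.sym

    same-trans : ∀ x y z → Same x y → Same y z → Same x z
    same-trans (inj₁ _) (inj₁ _) (inj₁ _) = E₁.trans
    same-trans (inj₂ _) (inj₂ _) (inj₂ _) = E₂.trans

    same-nc : ∀ a b c d → a ⊏ b → b ⊏ c → c ⊏ d → Same a c → Same b d → Same a b
    same-nc (inj₁ _) (inj₁ _) (inj₁ _) (inj₁ _) = N₁.nonCrossing
    same-nc (inj₁ _) (inj₂ _) (inj₁ _) (inj₂ _) _ ()
    same-nc (inj₂ _) (inj₁ _) (inj₂ _) (inj₁ _) ()
    same-nc (inj₂ _) (inj₂ _) (inj₂ _) (inj₂ _) = N₂.nonCrossing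

infixr 6 _⋄_

_⋄_ : NC n₁ → NC n₂ → NC (n₁ + n₂)
π₁@(B₁ ,ʳ _) ⋄ π₂@(B₂ ,ʳ _) = concatBlocks B₁ B₂ ,ʳ
  [ Concat.isNonCrossing-concat B₁ B₂ (isNonCrossing π₁) (isNonCrossing π₂) ]

IsInterval : Subset n → Set
IsInterval V = ∀ i j k → i ≤ᶠ j → j ≤ᶠ k → i ∈ V → k ∈ V → j ∈ V

Int : Pred (NC n) _
Int π = ∀ i → IsInterval (block π i)

Int? : Decidable (Int {n})
Int? π = Fin.all? λ l → Fin.all? λ i → Fin.all? λ j → Fin.all? λ k →
  i Fin.≤? j →-dec j Fin.≤? k →-dec
  i ∈? block π l →-dec k ∈? block π l →-dec j ∈? block π l

-- Complete lists, without repetitions.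

vectors : List A → (n : ℕ) → List (Vec A n)
vectors xs zero    = [] ∷ []
vectors xs (suc n) = cartesianProductWith _∷_ xs (vectors xs n)

refine : Decidable P → List A → List (Refinement A P)
refine P? []       = []
refine P? (x ∷ xs) with P? x
... | yes px = (x ,ʳ [ px ]) ∷ refine P? xs
... | no  _  = refine P? xs

allNC : (n : ℕ) → List (NC n)
allNC n = refine isNonCrossing? (vectors (vectors (inside ∷ outside ∷ []) n) n)

Between : NC n → NC n → Set
Between {n} π σ = [ ρ ∈ NC n ∣ (π ≤ ρ × ρ ≤ σ) ]

between : (π σ : NC n) → List (Between π σ)
between {n} π σ = refine (λ ρ → (π ≤? ρ) ×-dec (ρ ≤? σ)) (allNC n)

record NC² : Set where
  constructor pair
  field
    {size}         : ℕ
    .{{size≢0}}    : NonZero size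
    lower upper    : NC size
    .lower≤upper   : lower ≤ upper

toTop : .{{NonZero n}} → NC n → NC²
toTop π = pair π 1ₙ (≤1ₙ π)

∣block∣≢0 : (σ : NC n) (i : Fin n) → NonZero ∣ block σ i ∣
∣block∣≢0 σ i = nonZero (∼-refl σ)
  where
  nonZero : {V : Subset n} {i : Fin n} → i ∈ V → NonZero ∣ V ∣
  nonZero                here      = _
  nonZero {V = inside  ∷ _} (there _) = _
  nonZero {V = outside ∷ _} (there x) = nonZero x

-- (π_W , 1_{|W|}) for W the block of σ containing i.
onBlock : (π σ : NC n) → Fin n → NC²
onBlock π σ i = toTop {{∣block∣≢0 σ i}} (π ↾ block σ i)

+-nonZero : ∀ m n .{{_ : NonZero m}} → NonZero (m + n)
+-nonZero (suc _) _ = _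

elements-≤ : (W : Subset n) {i j : Fin ∣ W ∣} → i ≤ᶠ j → elements W i ≤ᶠ elements W j
elements-≤ (inside  ∷ W) {zero}          _         = z≤n
elements-≤ (inside  ∷ W) {suc i} {suc j} (s≤s i≤j) = s≤s (elements-≤ W i≤j)
elements-≤ (outside ∷ W)                 i≤j       = s≤s (elements-≤ W i≤j)

elements-∈ : (W : Subset n) (i : Fin ∣ W ∣) → elements W i ∈ W
elements-∈ (inside  ∷ W) zero    = here
elements-∈ (inside  ∷ W) (suc i) = there (elements-∈ W i)
elements-∈ (outside ∷ W) i       = there (elements-∈ W i)

Int-↾ : (π : NC n) (W : Subset n) → Int π → Int (π ↾ W)
Int-↾ π@(B ,ʳ _) W int l i j k i≤j j≤k x y = ∈-restrict⁺ B W
  (int _ _ _ _ (elements-≤ W i≤j) (elements-≤ W j≤k)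
    (∈-restrict⁻ B W x) (∈-restrict⁻ B W y))

index : Fin n → Fin ∣ ⊤ {n} ∣
index zero    = zero
index (suc i) = suc (index i)

elements-index : (i : Fin n) → elements ⊤ (index i) ≡ i
elements-index zero    = refl
elements-index (suc i) = cong suc (elements-index i)

index-≤ : {i j : Fin n} → i ≤ᶠ j → index i ≤ᶠ index j
index-≤ {i = zero}          _         = z≤n
index-≤ {i = suc _} {suc _} (s≤s i≤j) = s≤s (index-≤ i≤j)

Int-↾⊤⁻ : (π : NC n) → Int (π ↾ ⊤) → Int π
Int-↾⊤⁻ π@(B ,ʳ _) int l i j k i≤j j≤k x y =
  subst₂ R (elements-index l) (elements-index j) (∈-restrict⁻ B ⊤
    (int _ _ _ _ (index-≤ i≤j) (index-≤ j≤k) (index-∈ x) (index-∈ y)))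
  where
  R : Fin _ → Fin _ → Set
  R u v = v ∈ lookup B u
  index-∈ : ∀ {u v} → R u v → index v ∈ lookup (restrictBlocks B ⊤) (index u)
  index-∈ {u} {v} z = ∈-restrict⁺ B ⊤
    (subst₂ R (sym (elements-index u)) (sym (elements-index v)) z)

Int-↾-block : (π : NC n) (i : Fin n) → Int (π ↾ block π i)
Int-↾-block π@(B ,ʳ _) i l _ j _ _ _ _ _ = ∈-restrict⁺ B (block π i)
  (∼-trans π (∼-sym π (elements-∈ _ l)) (elements-∈ _ j))

leastElements-1ₙ : ∀ n → leastElements (1ₙ {suc n}) ≡ zero ∷ []
leastElements-1ₙ n = trans
  (filter-accept (isLeast? 1ₙ) {xs = tabulateˡ suc} (λ _ _ → z≤n))
  (cong (zero ∷_) (filter-none (isLeast? 1ₙ) (tabulate⁺ later)))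
  where
  open import Data.List.Base using () renaming (tabulate to tabulateˡ)
  open import Data.List.Properties using (filter-accept; filter-none)
  open import Data.List.Relation.Unary.All.Properties using (tabulate⁺)
  later : (i : Fin n) → ¬ IsLeast (1ₙ {suc n}) (suc i)
  later i least with () ← least zero (lookup-⊤ (suc i) zero)

-- The values lie in a commutative ring R, of which only the ring operations
-- are used; the classical case is the field of complex numbers.
module Functions {c ℓ} (R : CommutativeRing c ℓ) where

  private module R = CommutativeRing R
  open R using (Carrier; _≈_; 0#; 1#) renaming (_+_ to _⊕_; _*_ to _⊗_)

  infix 4 _≋_
  infixl 7 _⋆_

  Function : Set c
  Function = NC² → Carrier

  _≋_ : Function → Function → Set ℓ
  f ≋ g = ∀ x → f x ≈ g x

  ∑ ∏ : List A → (A → Carrier) → Carrier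
  ∑ xs f = foldr (λ x s → f x ⊕ s) 0# xs
  ∏ xs f = foldr (λ x s → f x ⊗ s) 1# xs

  ∏-blocks : (π σ : NC n) → Function → Carrier
  ∏-blocks π σ g = ∏ (leastElements σ) λ i → g (onBlock π σ i)

  _⋆_ : Function → Function → Function
  (f ⋆ g) (pair π σ _) =
    ∑ (between π σ) λ { (ρ ,ʳ [ πρσ ]) → f (pair π ρ (proj₁ πρσ)) ⊗ g (pair ρ σ (proj₂ πρσ)) }

  record G̃ (g : Function) : Set ℓ where
    field
      unit           : ∀ {n} .{{_ : NonZero n}} (π : NC n) → g (pair π π (≤-refl π)) ≈ 1#
      multiplicative : ∀ {n} .{{_ : NonZero n}} (π σ : NC n) .(π≤σ : π ≤ σ) →
                       g (pair π σ π≤σ) ≈ ∏-blocks π σ g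

  CumulantToMoment CumulantToCumulant : Pred Function ℓ
  CumulantToMoment g =
    ∀ {n₁ n₂} .{{_ : NonZero n₁}} .{{_ : NonZero n₂}} (π₁ : NC n₁) (π₂ : NC n₂) →
    g (toTop {{+-nonZero n₁ n₂}} (π₁ ⋄ π₂)) ≈ g (toTop π₁) ⊗ g (toTop π₂)
  CumulantToCumulant g =
    ∀ {n₁ n₂} .{{_ : NonZero n₁}} .{{_ : NonZero n₂}} (π₁ : NC n₁) (π₂ : NC n₂) →
    g (toTop {{+-nonZero n₁ n₂}} (π₁ ⋄ π₂)) ≈ 0#

  G̃-cm G̃-cc : Pred Function ℓ
  G̃-cm = G̃ ∩ CumulantToMoment
  G̃-cc = G̃ ∩ CumulantToCumulant

  intIndicator : NC n → Carrier
  intIndicator π = if does (Int? π) then 1# else 0#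

  -- The extension to NC² of intIndicator, regarded as the values g(π,1ₙ), by
  -- g(π,σ) = ∏_{W ∈ σ} g(π_W,1_{|W|}).  The lemmas below show that it is the
  -- unique member of G̃ with these values.
  g-bc-m : Function
  g-bc-m (pair π σ _) = ∏ (leastElements σ) λ i → intIndicator (π ↾ block σ i)

  ∏-cong : (xs : List A) {f g : A → Carrier} → (∀ x → f x ≈ g x) → ∏ xs f ≈ ∏ xs g
  ∏-cong []       f≈g = R.refl
  ∏-cong (x ∷ xs) f≈g = R.*-cong (f≈g x) (∏-cong xs f≈g)

  ∏-1 : (xs : List A) {f : A → Carrier} → (∀ x → f x ≈ 1#) → ∏ xs f ≈ 1#
  ∏-1 []       f≈1 = R.refl
  ∏-1 (x ∷ xs) f≈1 = R.trans (R.*-cong (f≈1 x) (∏-1 xs f≈1)) (R.*-identityˡ 1#)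

  intIndicator-yes : (π : NC n) → Int π → intIndicator π ≈ 1#
  intIndicator-yes π int rewrite dec-true (Int? π) int = R.refl

  intIndicator-no : (π : NC n) → ¬ Int π → intIndicator π ≈ 0#
  intIndicator-no π ¬int rewrite dec-false (Int? π) ¬int = R.refl

  g-bc-m-toTop : .{{_ : NonZero n}} (π : NC n) → g-bc-m (toTop π) ≈ intIndicator π
  g-bc-m-toTop {n = suc n} π
    rewrite leastElements-1ₙ n
          | does-⇔ (mk⇔ (Int-↾⊤⁻ π) (Int-↾ π ⊤)) (Int? (π ↾ ⊤)) (Int? π)
    = R.*-identityʳ _

  g-bc-m-Int : .{{_ : NonZero n}} (π : NC n) → Int π → g-bc-m (toTop π) ≈ 1#
  g-bc-m-Int π int = R.trans (g-bc-m-toTop π) (intIndicator-yes π int)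

  g-bc-m-¬Int : .{{_ : NonZero n}} (π : NC n) → ¬ Int π → g-bc-m (toTop π) ≈ 0#
  g-bc-m-¬Int π ¬int = R.trans (g-bc-m-toTop π) (intIndicator-no π ¬int)

  g-bc-m∈G̃ : G̃ g-bc-m
  g-bc-m∈G̃ = record
    { unit           = λ π → ∏-1 (leastElements π) λ i →
                         intIndicator-yes (π ↾ block π i) (Int-↾-block π i)
    ; multiplicative = λ π σ _ → ∏-cong (leastElements σ) λ i →
                         R.sym (g-bc-m-toTop {{∣block∣≢0 σ i}} (π ↾ block σ i)) }

  g-bc-m-unique : (g : Function) → G̃ g →
    (∀ {n} .{{_ : NonZero n}} (π : NC n) → Int π → g (toTop π) ≈ 1#) →
    (∀ {n} .{{_ : NonZero n}} (π : NC n) → ¬ Int π → g (toTop π) ≈ 0#) →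
    g ≋ g-bc-m
  g-bc-m-unique g g∈G̃ yes! no! (pair π σ π≤σ) =
    R.trans (G̃.multiplicative g∈G̃ π σ π≤σ) (∏-cong (leastElements σ) λ i →
      value-at {{∣block∣≢0 σ i}} (π ↾ block σ i))
    where
    value-at : ∀ {n} .{{_ : NonZero n}} (π : NC n) → g (toTop π) ≈ intIndicator π
    value-at π with Int? π
    ... | yes int = R.trans (yes! π int) (R.sym (intIndicator-yes π int))
    ... | no ¬int = R.trans (no! π ¬int) (R.sym (intIndicator-no π ¬int))

{-# OPTIONS --safe #-}
-- If g is of cumulant-to-cumulant type, then g(π,ρ) vanishes as soon as π is a
-- concatenation on some block of ρ, while g-bc-m(ρ,σ) is the indicator of ρ
-- being an interval partition on every block of σ.  So the sum defining
-- (g ⋆ g-bc-m)(π,σ) has a single non-zero term, at the partition κ(π,σ) that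
-- cuts each block of σ into the irreducible components of π on it, and
-- (g ⋆ g-bc-m)(π,σ) = g(π,κ(π,σ)).  For any k ∈ G̃ the function k(π,κ(π,σ)) is
-- again in G̃, because κ commutes with restriction to the blocks of σ, and it is
-- of cumulant-to-moment type, because κ(π₁⋄π₂,1) = κ(π₁⋄π₂,1⋄1).  Conversely,
-- h of cumulant-to-moment type satisfies h(π,κ(π,σ)) = h(π,σ), so it arises from
-- the g with g(π,1) = h(π,1) for irreducible π and g(π,1) = 0 otherwise.
module Submission where

open import Defs
open import Algebra.Bundles using (CommutativeRing)
open import Data.Bool.Base using (true; if_then_else_)
open import Data.Fin.Base using (Fin; zero; suc; toℕ; fromℕ<; inject; _↑ˡ_; _↑ʳ_; splitAt; join)
  renaming (_≤_ to _≤ᶠ_; _<_ to _<ᶠ_)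
import Data.Fin.Induction as Fin
import Data.Fin.Properties as Fin
open import Data.Fin.Subset using (Subset; Side; inside; outside; ⊤; ∣_∣)
  renaming (_∈_ to _∈ˢ_; _∉_ to _∉ˢ_)
open import Data.Fin.Subset.Properties using (_∈?_; ⊆-antisym; ∈⊤)
open import Data.Irrelevant using ([_])
open import Data.List.Base using (List; []; _∷_; filter) renaming (tabulate to tabulateˡ)
open import Data.List.Membership.Propositional using () renaming (_∈_ to _∈ˡ_)
open import Data.List.Membership.Propositional.Properties
  using (∈-cartesianProductWith⁺; ∈-filter⁺; ∈-allFin)
open import Data.List.Relation.Unary.All as All using (All; []; _∷_)
open import Data.List.Relation.Unary.AllPairs using ([]; _∷_)
open import Data.List.Relation.Unary.Any using (here; there)
open import Data.List.Relation.Unary.Unique.Propositional using (Unique)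
open import Data.List.Relation.Unary.Unique.Propositional.Properties using (cartesianProductWith⁺)
open import Data.Nat.Base using (ℕ; zero; suc; NonZero; >-nonZero; >-nonZero⁻¹; _+_; s≤s; z≤n)
  renaming (_≤_ to _≤ⁿ_; _<_ to _<ⁿ_)
import Data.Nat.Induction as ℕ
import Data.Nat.Properties as ℕ
open import Data.Product using (_×_; _,_; _,′_; proj₁; proj₂; ∃-syntax)
open import Data.Refinement using (value) renaming (_,_ to _,ʳ_)
open import Data.Sum as Sum using (_⊎_; inj₁; inj₂; swap)
open import Data.Vec.Base using (Vec; []; _∷_; here; there; lookup; tabulate)
open import Data.Vec.Properties
  using (lookup∘tabulate; tabulate∘lookup; tabulate-cong; lookup⇒[]=; []=⇒lookup; ∷-injective)
open import Function.Base using (_∘_; id; case_of_)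
open import Induction.WellFounded using (Acc; acc)
open import Level using (Level)
open import Relation.Binary.Definitions using (tri<; tri≈; tri>)
open import Relation.Binary.PropositionalEquality
  using (_≡_; _≢_; refl; sym; trans; cong; subst; subst₂; module ≡-Reasoning)
open import Relation.Binary.Structures using (IsEquivalence)
open import Relation.Nullary using (¬_; ¬?; Dec; yes; no; does; contradiction; recompute)
open import Relation.Nullary.Decidable
  using (_×-dec_; _→-dec_; _⊎-dec_; dec-true; dec-false; decidable-stable)
open import Relation.Unary using (Decidable; _≐_; _∈_)

private
  variable
    a b : Level
    A : Set a
    P : A → Set b
    m n p q n₁ n₂ : ℕ

-- Equality and order of partitions, and partitions from relations.

module _ (π ρ : NC n) where

  NC-ext : (∀ {i j} → j ∈ˢ block π i → j ∈ˢ block ρ i) →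
           (∀ {i j} → j ∈ˢ block ρ i → j ∈ˢ block π i) → π ≡ ρ
  NC-ext π⊆ρ ρ⊆π = value-injective (begin
    value π               ≡⟨ tabulate∘lookup (value π) ⟨
    tabulate (block π)    ≡⟨ tabulate-cong (λ _ → ⊆-antisym π⊆ρ ρ⊆π) ⟩
    tabulate (block ρ)    ≡⟨ tabulate∘lookup (value ρ) ⟩
    value ρ               ∎)
    where
    open ≡-Reasoning
    value-injective : ∀ {π ρ : NC n} → value π ≡ value ρ → π ≡ ρ
    value-injective refl = refl

  ≤⇒⊆ : π ≤ ρ → ∀ {i j} → j ∈ˢ block π i → j ∈ˢ block ρ i
  ≤⇒⊆ π≤ρ {i} = π≤ρ i i (∼-refl ρ)

  ⊆⇒≤ : (∀ {i j} → j ∈ˢ block π i → j ∈ˢ block ρ i) → π ≤ ρ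
  ⊆⇒≤ π⊆ρ i j j∈i k∈j = ∼-trans ρ j∈i (π⊆ρ k∈j)

≤-antisym : (π ρ : NC n) → π ≤ ρ → ρ ≤ π → π ≡ ρ
≤-antisym π ρ π≤ρ ρ≤π = NC-ext π ρ (≤⇒⊆ π ρ π≤ρ) (≤⇒⊆ ρ π ρ≤π)

block-≡ : (π : NC n) {i j : Fin n} → j ∈ˢ block π i → block π i ≡ block π j
block-≡ π j∈i = ⊆-antisym (∼-trans π (∼-sym π j∈i)) (∼-trans π j∈i)

does-true⁻ : ∀ {a} {A : Set a} (A? : Dec A) → does A? ≡ true → A
does-true⁻ (yes a) _ = a

module _ {_∼_ : Fin n → Fin n → Set} (_∼?_ : ∀ i j → Dec (i ∼ j)) where

  classes : Vec (Subset n) n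
  classes = tabulate λ i → tabulate λ j → does (i ∼? j)

  private
    entry : ∀ i j → lookup (lookup classes i) j ≡ does (i ∼? j)
    entry i j = trans (cong (λ V → lookup V j) (lookup∘tabulate _ i)) (lookup∘tabulate _ j)

  ∈-classes⁺ : ∀ {i j} → i ∼ j → j ∈ˢ lookup classes i
  ∈-classes⁺ {i} {j} i∼j = lookup⇒[]= j _ (trans (entry i j) (dec-true (i ∼? j) i∼j))

  ∈-classes⁻ : ∀ {i j} → j ∈ˢ lookup classes i → i ∼ j
  ∈-classes⁻ {i} {j} j∈i = does-true⁻ (i ∼? j) (trans (sym (entry i j)) ([]=⇒lookup j∈i))

  fromRelation : IsEquivalence _∼_ →
    (∀ {a b c d} → a <ᶠ b → b <ᶠ c → c <ᶠ d → a ∼ c → b ∼ d → a ∼ b) → NC n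
  fromRelation equiv nc = classes ,ʳ [ record
    { isEquivalence = record
      { refl  = ∈-classes⁺ E.refl
      ; sym   = λ x → ∈-classes⁺ (E.sym (∈-classes⁻ x))
      ; trans = λ x y → ∈-classes⁺ (E.trans (∈-classes⁻ x) (∈-classes⁻ y)) }
    ; nonCrossing = λ a<b b<c c<d x y →
        ∈-classes⁺ (nc a<b b<c c<d (∈-classes⁻ x) (∈-classes⁻ y)) } ]
    where module E = IsEquivalence equiv

-- Monotone maps and restriction

StrictlyMonotone : (Fin p → Fin q) → Set
StrictlyMonotone φ = ∀ {i j} → i <ᶠ j → φ i <ᶠ φ j

module _ {φ : Fin p → Fin q} (φ-mono : StrictlyMonotone φ) where

  mono-≤ : ∀ {i j} → i ≤ᶠ j → φ i ≤ᶠ φ j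
  mono-≤ {i} {j} i≤j with Fin.<-cmp i j
  ... | tri< i<j _ _    = ℕ.<⇒≤ (φ-mono i<j)
  ... | tri≈ _ refl _   = ℕ.≤-refl
  ... | tri> _ _ j<i    = contradiction i≤j (ℕ.<⇒≱ j<i)

  reflects-< : ∀ {i j} → φ i <ᶠ φ j → i <ᶠ j
  reflects-< {i} {j} φi<φj with j Fin.≤? i
  ... | yes j≤i = contradiction (mono-≤ j≤i) (ℕ.<⇒≱ φi<φj)
  ... | no  j≰i = ℕ.≰⇒> j≰i

  reflects-≤ : ∀ {i j} → φ i ≤ᶠ φ j → i ≤ᶠ j
  reflects-≤ {i} {j} φi≤φj with i Fin.≤? j
  ... | yes i≤j = i≤j
  ... | no  i≰j = contradiction φi≤φj (ℕ.<⇒≱ (φ-mono (ℕ.≰⇒> i≰j)))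

  mono-injective : ∀ {i j} → φ i ≡ φ j → i ≡ j
  mono-injective eq = Fin.≤-antisym (reflects-≤ (Fin.≤-reflexive eq))
                                 (reflects-≤ (Fin.≤-reflexive (sym eq)))

  -- A strictly increasing map gains at least one at every step.
  mono-inflationary : ∀ i → toℕ i ≤ⁿ toℕ (φ i)
  mono-inflationary = go (toℕ ∘ φ) 0 φ-mono (λ _ → z≤n)
    where
    -- The lower bound `c` is generalised because dropping the first point raises it by one.
    go : ∀ {p} (f : Fin p → ℕ) c → (∀ {i j} → i <ᶠ j → f i <ⁿ f j) →
         (∀ i → c ≤ⁿ f i) → ∀ i → c + toℕ i ≤ⁿ f i
    go f c mono c≤ zero    rewrite ℕ.+-identityʳ c = c≤ zero
    go f c mono c≤ (suc i) rewrite ℕ.+-suc c (toℕ i) =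
      go (f ∘ suc) (suc c) (λ i<j → mono (s≤s i<j))
        (λ j → ℕ.≤-<-trans (c≤ zero) (mono (s≤s z≤n))) i

  pullback : NC q → NC p
  pullback π = fromRelation {_∼_ = λ i j → φ j ∈ˢ block π (φ i)} (λ i j → φ j ∈? block π (φ i))
    (record { refl = ∼-refl π ; sym = ∼-sym π ; trans = ∼-trans π })
    (λ a<b b<c c<d → nonCrossing π (φ-mono a<b) (φ-mono b<c) (φ-mono c<d))

  module _ (π : NC q) where
    ∈-pullback⁺ : ∀ {i j} → φ j ∈ˢ block π (φ i) → j ∈ˢ block (pullback π) i
    ∈-pullback⁺ = ∈-classes⁺ (λ i j → φ j ∈? block π (φ i))

    ∈-pullback⁻ : ∀ {i j} → j ∈ˢ block (pullback π) i → φ j ∈ˢ block π (φ i)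
    ∈-pullback⁻ = ∈-classes⁻ (λ i j → φ j ∈? block π (φ i))

elements-surjective : {W : Subset n} {x : Fin n} → x ∈ˢ W → ∃[ i ] elements W i ≡ x
elements-surjective                    here      = zero , refl
elements-surjective {W = inside  ∷ _} (there x) =
  let i , eq = elements-surjective x in suc i , cong suc eq
elements-surjective {W = outside ∷ _} (there x) =
  let i , eq = elements-surjective x in i , cong suc eq

↾-∈⁺ : (π : NC n) (W : Subset n) {i j : Fin ∣ W ∣} →
       elements W j ∈ˢ block π (elements W i) → j ∈ˢ block (π ↾ W) i
↾-∈⁺ (B ,ʳ _) W = ∈-restrict⁺ B W

↾-∈⁻ : (π : NC n) (W : Subset n) {i j : Fin ∣ W ∣} →
       j ∈ˢ block (π ↾ W) i → elements W j ∈ˢ block π (elements W i)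
↾-∈⁻ (B ,ʳ _) W = ∈-restrict⁻ B W

-- The sizes `p` and `q` agree only up to a proof, so `f` takes the place of the cast between them;
-- once `eq` is matched, preserving `toℕ` makes it the identity.
toTop-≡ : .{{_ : NonZero p}} .{{_ : NonZero q}} (eq : p ≡ q) (π : NC p) (ρ : NC q)
  (f : Fin p → Fin q) → (∀ i → toℕ (f i) ≡ toℕ i) →
  (∀ {i j} → j ∈ˢ block π i → f j ∈ˢ block ρ (f i)) →
  (∀ {i j} → f j ∈ˢ block ρ (f i) → j ∈ˢ block π i) → toTop π ≡ toTop ρ
toTop-≡ {p} refl π ρ f f-toℕ π⊆ρ ρ⊆π = cong (λ π → toTop π) (NC-ext π ρ
  (λ {i} {j} x → subst₂ Rρ (f-id i) (f-id j) (π⊆ρ x))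
  (λ {i} {j} x → ρ⊆π (subst₂ Rρ (sym (f-id i)) (sym (f-id j)) x)))
  where
  Rρ : Fin p → Fin p → Set
  Rρ i j = j ∈ˢ block ρ i
  f-id : ∀ i → f i ≡ i
  f-id i = Fin.toℕ-injective (f-toℕ i)

module _ .{{_ : NonZero p}} (π : NC p) (ρ : NC n) (W : Subset n) .{{_ : NonZero ∣ W ∣}}
  {φ : Fin p → Fin n} (φ-mono : StrictlyMonotone φ)
  (φ-∈ : ∀ i → φ i ∈ˢ W) (φ-onto : ∀ {x} → x ∈ˢ W → ∃[ i ] φ i ≡ x)
  (π⊆ρ : ∀ {i j} → j ∈ˢ block π i → φ j ∈ˢ block ρ (φ i))
  (ρ⊆π : ∀ {i j} → φ j ∈ˢ block ρ (φ i) → j ∈ˢ block π i)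
  where

  -- The enumerations `φ` and `elements W` have the same image, so passing from one to the other
  -- gives increasing maps `f` and `g` with `g (f i) ≡ i`. Both are inflationary, whence
  -- `i ≤ f i ≤ g (f i) = i`, and `f` preserves `toℕ`. Restrictions to iterated or concatenated
  -- blocks are identified through this.
  toTop-embed : toTop π ≡ toTop (ρ ↾ W)
  toTop-embed = toTop-≡ (ℕ.≤-antisym (Fin.injective⇒≤ (mono-injective f-mono))
                                     (Fin.injective⇒≤ (mono-injective g-mono)))
    π (ρ ↾ W) f f-toℕ
    (λ {i} {j} x → ↾-∈⁺ ρ W (subst₂ R (sym (el-f i)) (sym (el-f j)) (π⊆ρ x)))
    (λ {i} {j} x → ρ⊆π (subst₂ R (el-f i) (el-f j) (↾-∈⁻ ρ W x)))
    where
    R : Fin n → Fin n → Set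
    R i j = j ∈ˢ block ρ i
    el-mono : StrictlyMonotone (elements W)
    el-mono = elements-< W
    f : Fin p → Fin ∣ W ∣
    f i = proj₁ (elements-surjective (φ-∈ i))
    el-f : ∀ i → elements W (f i) ≡ φ i
    el-f i = proj₂ (elements-surjective (φ-∈ i))
    g : Fin ∣ W ∣ → Fin p
    g j = proj₁ (φ-onto (elements-∈ W j))
    φ-g : ∀ j → φ (g j) ≡ elements W j
    φ-g j = proj₂ (φ-onto (elements-∈ W j))
    f-mono : StrictlyMonotone f
    f-mono {i} {j} i<j = reflects-< el-mono
      (subst₂ _<ᶠ_ (sym (el-f i)) (sym (el-f j)) (φ-mono i<j))
    g-mono : StrictlyMonotone g
    g-mono {i} {j} i<j = reflects-< φ-mono
      (subst₂ _<ᶠ_ (sym (φ-g i)) (sym (φ-g j)) (el-mono i<j))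
    g-f : ∀ i → g (f i) ≡ i
    g-f i = mono-injective φ-mono (trans (φ-g (f i)) (el-f i))
    f-toℕ : ∀ i → toℕ (f i) ≡ toℕ i
    f-toℕ i = ℕ.≤-antisym
      (ℕ.≤-trans (mono-inflationary g-mono (f i)) (ℕ.≤-reflexive (cong toℕ (g-f i))))
      (mono-inflationary f-mono i)

toTop-↾⊤ : .{{_ : NonZero n}} .{{_ : NonZero ∣ ⊤ {n} ∣}} (π : NC n) → toTop (π ↾ ⊤) ≡ toTop π
toTop-↾⊤ π = sym (toTop-embed π π ⊤ id (λ _ → ∈⊤) (λ _ → _ , refl) id id)

-- The enumeration of `U` followed by that of `V` is an increasing enumeration of `W`.
toTop-↾↾ : (π : NC n) (V W : Subset n) (U : Subset ∣ V ∣)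
  .{{_ : NonZero ∣ W ∣}} .{{_ : NonZero ∣ U ∣}} →
  (∀ {x} → x ∈ˢ W → x ∈ˢ V) →
  (∀ {i} → i ∈ˢ U → elements V i ∈ˢ W) → (∀ {i} → elements V i ∈ˢ W → i ∈ˢ U) →
  toTop (π ↾ V ↾ U) ≡ toTop (π ↾ W)
toTop-↾↾ π V W U W⊆V U⊆W W⊆U = toTop-embed (π ↾ V ↾ U) π W
  (λ i<j → elements-< V (elements-< U i<j))
  (λ i → U⊆W (elements-∈ U i))
  onto
  (λ x → ↾-∈⁻ π V (↾-∈⁻ (π ↾ V) U x))
  (λ x → ↾-∈⁺ (π ↾ V) U (↾-∈⁺ π V x))
  where
  onto : ∀ {x} → x ∈ˢ W → ∃[ i ] elements V (elements U i) ≡ x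
  onto x∈W with elements-surjective (W⊆V x∈W)
  ... | y , refl with elements-surjective (W⊆U x∈W)
  ... | z , refl = z , refl

-- A point `k` stands for the gap just before it. The two alternatives cover both orders of `i` and
-- `j`.
CutsBetween : Fin n → Fin n → Fin n → Set
CutsBetween i j k = (i <ᶠ k × k ≤ᶠ j) ⊎ (j <ᶠ k × k ≤ᶠ i)

-- Irreducible components

Crossed : NC n → Fin n → Set
Crossed π k = ∃[ a ] ∃[ b ] (a <ᶠ k × k ≤ᶠ b × b ∈ˢ block π a)

crossed? : (π : NC n) (k : Fin n) → Dec (Crossed π k)
crossed? π k = Fin.any? λ a → Fin.any? λ b →
  (a Fin.<? k) ×-dec (k Fin.≤? b) ×-dec (b ∈? block π a)

-- The point `i` excludes the first point, which has no gap before it.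
Irreducible : NC n → Set
Irreducible {n} π = ∀ (i k : Fin n) → i <ᶠ k → Crossed π k

irreducible? : (π : NC n) → Dec (Irreducible π)
irreducible? π = Fin.all? λ i → Fin.all? λ k → (i Fin.<? k) →-dec crossed? π k

module _ (π σ : NC n) where

  -- The analogue of `Crossed` inside the block of `σ` that contains `k`: for `π ≤ σ` the point `b`
  -- lies in that block too.
  Bridged : Fin n → Set
  Bridged k = ∃[ a ] ∃[ b ] (a ∈ˢ block σ k × a <ᶠ k × k ≤ᶠ b × b ∈ˢ block π a)

  Linked : Fin n → Fin n → Set
  Linked i j = j ∈ˢ block σ i × (∀ k → k ∈ˢ block σ i → CutsBetween i j k → Bridged k)

  linked? : ∀ i j → Dec (Linked i j)
  linked? i j = j ∈? block σ i ×-dec Fin.all? λ k → k ∈? block σ i →-dec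
    (((i Fin.<? k) ×-dec (k Fin.≤? j)) ⊎-dec ((j Fin.<? k) ×-dec (k Fin.≤? i))) →-dec
    Fin.any? λ a → Fin.any? λ b →
      (a ∈? block σ k) ×-dec (a Fin.<? k) ×-dec (k Fin.≤? b) ×-dec (b ∈? block π a)

  -- For transitivity, a gap between `i` and `l` is also between `i` and `j` or between `j` and `l`,
  -- according to the side of `j` on which it lies.
  linked-isEquivalence : IsEquivalence Linked
  linked-isEquivalence = record
    { refl  = ∼-refl σ , λ where
        _ _ (inj₁ (i<k , k≤i)) → contradiction k≤i (ℕ.<⇒≱ i<k)
        _ _ (inj₂ (i<k , k≤i)) → contradiction k≤i (ℕ.<⇒≱ i<k)
    ; sym   = λ (j∈i , x) → ∼-sym σ j∈i , λ k k∈j b → x k (∼-trans σ j∈i k∈j) (swap b)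
    ; trans = tr }
    where
    tr : ∀ {i j l} → Linked i j → Linked j l → Linked i l
    tr {i} {j} {l} (j∈i , x) (l∈j , y) = ∼-trans σ j∈i l∈j , bridge
      where
      bridge : ∀ k → k ∈ˢ block σ i → CutsBetween i l k → Bridged k
      bridge k k∈i b with k Fin.≤? j | b
      ... | yes k≤j | inj₁ (i<k , k≤l) = x k k∈i (inj₁ (i<k , k≤j))
      ... | yes k≤j | inj₂ (l<k , k≤i) = y k (∼-trans σ (∼-sym σ j∈i) k∈i) (inj₂ (l<k , k≤j))
      ... | no  k≰j | inj₁ (i<k , k≤l) = y k (∼-trans σ (∼-sym σ j∈i) k∈i) (inj₁ (ℕ.≰⇒> k≰j , k≤l))
      ... | no  k≰j | inj₂ (l<k , k≤i) = x k k∈i (inj₂ (ℕ.≰⇒> k≰j , k≤i))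

  -- Non-crossing of `σ` puts `a` and `b` in one block, and the gaps between them are among those
  -- between `a` and `c`, which are all bridged.
  linked-nonCrossing : ∀ {a b c d} → a <ᶠ b → b <ᶠ c → c <ᶠ d →
                       Linked a c → Linked b d → Linked a b
  linked-nonCrossing a<b b<c c<d (c∈a , x) (d∈b , _) =
    nonCrossing σ a<b b<c c<d c∈a d∈b , λ where
      k k∈a (inj₁ (a<k , k≤b)) → x k k∈a (inj₁ (a<k , ℕ.≤-trans k≤b (ℕ.<⇒≤ b<c)))
      k k∈a (inj₂ (b<k , k≤a)) → contradiction k≤a (ℕ.<⇒≱ (ℕ.<-trans a<b b<k))

  abstract
    -- Refines every block of σ into the irreducible components of π on it; for
    -- π ≤ σ it is the least ρ in [π , σ] whose trace on each block of σ is an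
    -- interval partition.
    components : NC n
    components = fromRelation linked? linked-isEquivalence linked-nonCrossing

    ∈-components⁺ : ∀ {i j} → Linked i j → j ∈ˢ block components i
    ∈-components⁺ = ∈-classes⁺ linked?

    ∈-components⁻ : ∀ {i j} → j ∈ˢ block components i → Linked i j
    ∈-components⁻ = ∈-classes⁻ linked?

  -- The one pair `a`, `b` bridges every gap between `a` and `k`.
  bridge-∈ : ∀ {a k b} → a <ᶠ k → k ≤ᶠ b → k ∈ˢ block σ a → b ∈ˢ block π a →
             k ∈ˢ block components a
  bridge-∈ {a} {k} {b} a<k k≤b k∈a b∈a = ∈-components⁺ (k∈a , λ where
    l l∈a (inj₁ (a<l , l≤k)) → a , b , ∼-sym σ l∈a , a<l , ℕ.≤-trans l≤k k≤b , b∈a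
    l l∈a (inj₂ (k<l , l≤a)) → contradiction l≤a (ℕ.<⇒≱ (ℕ.<-trans a<k k<l)))

  components≤ : components ≤ σ
  components≤ = ⊆⇒≤ components σ (λ x → proj₁ (∈-components⁻ x))

  ≤components : π ≤ σ → π ≤ components
  ≤components π≤σ = ⊆⇒≤ π components inc
    where
    inc : ∀ {i j} → j ∈ˢ block π i → j ∈ˢ block components i
    inc {i} {j} j∈i with Fin.<-cmp i j
    ... | tri< i<j _ _  = bridge-∈ i<j ℕ.≤-refl (≤⇒⊆ π σ π≤σ j∈i) j∈i
    ... | tri≈ _ refl _ = ∼-refl components
    ... | tri> _ _ j<i  = ∼-sym components
      (bridge-∈ j<i ℕ.≤-refl (≤⇒⊆ π σ π≤σ (∼-sym π j∈i)) (∼-sym π j∈i))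

-- This and `IrreducibleOn` avoid renumbering the blocks. For `ρ ≤ σ` it expresses that `ρ` is an
-- interval partition on every block of `σ`; for `π ≤ ρ` the other expresses that `π` is irreducible
-- on every block of `ρ`.
IntervalIn : NC n → NC n → Set
IntervalIn ρ σ = ∀ {i j k} → i ≤ᶠ j → j ≤ᶠ k → j ∈ˢ block σ i → k ∈ˢ block ρ i → j ∈ˢ block ρ i

IrreducibleOn : NC n → NC n → Set
IrreducibleOn π ρ = ∀ {i k} → i <ᶠ k → k ∈ˢ block ρ i →
  ∃[ a ] ∃[ b ] (a ∈ˢ block ρ k × a <ᶠ k × k ≤ᶠ b × b ∈ˢ block π a)

-- The gaps between `i` and `j` are among those between `i` and `k`.
components-intervalIn : (π σ : NC n) → IntervalIn (components π σ) σ
components-intervalIn π σ {i} {j} {k} i≤j j≤k j∈i k∈i =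
  ∈-components⁺ π σ (j∈i , λ where
    l l∈i (inj₁ (i<l , l≤j)) →
      proj₂ (∈-components⁻ π σ k∈i) l l∈i (inj₁ (i<l , ℕ.≤-trans l≤j j≤k))
    l l∈i (inj₂ (j<l , l≤i)) → contradiction l≤i (ℕ.<⇒≱ (ℕ.≤-<-trans i≤j j<l)))

-- By `bridge-∈`, the left end `a` of a bridge over the gap before `k` lies in the component of `k`,
-- so the bridge stays within the component.
components-irreducibleOn : (π σ : NC n) → IrreducibleOn π (components π σ)
components-irreducibleOn π σ {i} {k} i<k k∈i with ∈-components⁻ π σ k∈i
... | k∈σi , x with x k k∈σi (inj₁ (i<k , ℕ.≤-refl))
... | a , b , a∈k , a<k , k≤b , b∈a =
  a , b , ∼-sym (components π σ) (bridge-∈ π σ a<k k≤b (∼-sym σ a∈k) b∈a) , a<k , k≤b , b∈a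

module _ (π ρ σ : NC n) (π≤ρ : π ≤ ρ) (int : IntervalIn ρ σ) where

  components-least : ρ ≤ σ → components π σ ≤ ρ
  components-least ρ≤σ = ⊆⇒≤ (components π σ) ρ inc
    where
    -- Strong induction on `k`: the gap before `k` is bridged by some `a < k ≤ b`, and `a`, `b`
    -- share a block of `ρ` because `π ≤ ρ`.
    step : ∀ {i j} → Linked π σ i j → ∀ k → Acc _<ᶠ_ k →
           k ∈ˢ block σ i → i ≤ᶠ k → k ≤ᶠ j → k ∈ˢ block ρ i
    step {i} {j} link@(_ , x) k (acc rs) k∈i i≤k k≤j with Fin.<-cmp i k
    ... | tri≈ _ refl _ = ∼-refl ρ
    ... | tri> _ _ k<i  = contradiction i≤k (ℕ.<⇒≱ k<i)
    ... | tri< i<k _ _ with x k k∈i (inj₁ (i<k , k≤j))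
    ... | a , b , a∈k , a<k , k≤b , b∈a with i Fin.≤? a
    -- By induction `a`, and hence `b`, lies in the block of `i`, and `k` is between `i` and `b`.
    ... | yes i≤a = int i≤k k≤b k∈i (∼-trans ρ
            (step link a (rs a<k) (∼-trans σ k∈i a∈k) i≤a (ℕ.≤-trans (ℕ.<⇒≤ a<k) k≤j))
            (≤⇒⊆ π ρ π≤ρ b∈a))
    -- The bridge spans both `i` and `k`, so the interval property puts both into the block of `a`.
    ... | no  i≰a = ∼-trans ρ (∼-sym ρ (inρ (ℕ.<⇒≤ (ℕ.≰⇒> i≰a)) (ℕ.≤-trans i≤k k≤b)
                       (∼-trans σ (∼-sym σ a∈k) (∼-sym σ k∈i))))
                      (inρ (ℕ.<⇒≤ a<k) k≤b (∼-sym σ a∈k))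
      where
      inρ : ∀ {l} → a ≤ᶠ l → l ≤ᶠ b → l ∈ˢ block σ a → l ∈ˢ block ρ a
      inρ a≤l l≤b l∈a = int a≤l l≤b l∈a (≤⇒⊆ π ρ π≤ρ b∈a)

    inc : ∀ {i j} → j ∈ˢ block (components π σ) i → j ∈ˢ block ρ i
    inc {i} {j} j∈i with Fin.≤-total i j | ∈-components⁻ π σ j∈i
    ... | inj₁ i≤j | link = step link j (Fin.<-wellFounded j) (proj₁ link) i≤j ℕ.≤-refl
    ... | inj₂ j≤i | link = ∼-sym ρ (step (L.sym link) i (Fin.<-wellFounded i)
            (proj₁ (L.sym link)) j≤i ℕ.≤-refl)
      where module L = IsEquivalence (linked-isEquivalence π σ)

  -- The interval property puts every gap of `σ` between two points of a block of `ρ` into that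
  -- block, where irreducibility bridges it; so `ρ` refines the components. The converse is their
  -- minimality.
  components-unique : ρ ≤ σ → IrreducibleOn π ρ → ρ ≡ components π σ
  components-unique ρ≤σ irr = ≤-antisym ρ (components π σ)
    (⊆⇒≤ ρ (components π σ) inc) (components-least ρ≤σ)
    where
    up : ∀ {i j} → i ≤ᶠ j → j ∈ˢ block ρ i → j ∈ˢ block (components π σ) i
    up {i} {j} i≤j j∈i = ∈-components⁺ π σ (≤⇒⊆ ρ σ ρ≤σ j∈i , λ where
      k k∈i (inj₁ (i<k , k≤j)) →
        let a , b , a∈k , rest = irr i<k (int (ℕ.<⇒≤ i<k) k≤j k∈i j∈i)
        in a , b , ≤⇒⊆ ρ σ ρ≤σ a∈k , rest
      k k∈i (inj₂ (j<k , k≤i)) → contradiction k≤i (ℕ.<⇒≱ (ℕ.≤-<-trans i≤j j<k)))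
    inc : ∀ {i j} → j ∈ˢ block ρ i → j ∈ˢ block (components π σ) i
    inc {i} {j} j∈i with Fin.≤-total i j
    ... | inj₁ i≤j = up i≤j j∈i
    ... | inj₂ j≤i = ∼-sym (components π σ) (up j≤i (∼-sym ρ j∈i))

components-refl : (π : NC n) → components π π ≡ π
components-refl π = ≤-antisym (components π π) π (components≤ π π) (≤components π π (≤-refl π))

-- Both sides see the same gaps and bridges. The interval property puts each gap of `σ` between two
-- points of a block of `τ` into that block, and minimality gives `components π σ ≤ τ`, which keeps
-- the left end of a bridge there.
components-interval : (π τ σ : NC n) → π ≤ τ → τ ≤ σ → IntervalIn τ σ →
                      components π σ ≡ components π τ
components-interval π τ σ π≤τ τ≤σ int = NC-ext (components π σ) (components π τ)
  (λ {i} {j} x → let j∈i , bridges = ∈-components⁻ π σ x in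
    ∈-components⁺ π τ (≤⇒⊆ (components π σ) τ c≤τ x , λ k k∈i b →
      let a , c , a∈k , a<k , k≤c , c∈a = bridges k (≤⇒⊆ τ σ τ≤σ k∈i) b in
      a , c ,
      ∼-sym τ (≤⇒⊆ (components π σ) τ c≤τ (bridge-∈ π σ a<k k≤c (∼-sym σ a∈k) c∈a)) ,
      a<k , k≤c , c∈a))
  (λ {i} {j} x → let j∈i , bridges = ∈-components⁻ π τ x in
    ∈-components⁺ π σ (≤⇒⊆ τ σ τ≤σ j∈i , λ k k∈i b →
      let a , c , a∈k , rest = bridges k (inside-τ j∈i k∈i b) b in
      a , c , ≤⇒⊆ τ σ τ≤σ a∈k , rest))
  where
  c≤τ : components π σ ≤ τ
  c≤τ = components-least π τ σ π≤τ int τ≤σ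
  inside-τ : ∀ {i j k} → j ∈ˢ block τ i → k ∈ˢ block σ i → CutsBetween i j k → k ∈ˢ block τ i
  inside-τ j∈i k∈i (inj₁ (i<k , k≤j)) = int (ℕ.<⇒≤ i<k) k≤j k∈i j∈i
  inside-τ j∈i k∈i (inj₂ (j<k , k≤i)) = ∼-trans τ j∈i (int (ℕ.<⇒≤ j<k) k≤i
    (∼-trans σ (≤⇒⊆ τ σ τ≤σ (∼-sym τ j∈i)) k∈i) (∼-sym τ j∈i))

module _ (π σ : NC n) (π≤σ : π ≤ σ) (l : Fin n) where
  private
    V : Subset n
    V = block σ l
    el : Fin ∣ V ∣ → Fin n
    el = elements V
    el-∈ : ∀ i j → el j ∈ˢ block σ (el i)
    el-∈ i j = ∼-trans σ (∼-sym σ (elements-∈ V i)) (elements-∈ V j)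

  -- The map `elements V` preserves and reflects the order, so gaps and bridges correspond; `π ≤ σ`
  -- keeps the right end of a bridge inside `V`.
  components-↾ : components (π ↾ V) 1ₙ ≡ components π σ ↾ V
  components-↾ = NC-ext (components (π ↾ V) 1ₙ) (components π σ ↾ V)
    (λ {i} {j} x → ↾-∈⁺ (components π σ) V
      (∈-components⁺ π σ (el-∈ i j , up i j (∈-components⁻ (π ↾ V) 1ₙ x))))
    (λ {i} {j} x → ∈-components⁺ (π ↾ V) 1ₙ
      (lookup-⊤ i j , down i j (∈-components⁻ π σ (↾-∈⁻ (components π σ) V x))))
    where
    up : ∀ i j → Linked (π ↾ V) 1ₙ i j →
         ∀ k → k ∈ˢ block σ (el i) → CutsBetween (el i) (el j) k → Bridged π σ k
    up i j (_ , x) k k∈i btw with elements-surjective (∼-trans σ (elements-∈ V i) k∈i)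
    ... | k′ , refl with x k′ (lookup-⊤ i k′) (Sum.map reflect reflect btw)
      where
      reflect : ∀ {u v w} → el u <ᶠ el v × el v ≤ᶠ el w → u <ᶠ v × v ≤ᶠ w
      reflect (s , t) = reflects-< (elements-< V) s , reflects-≤ (elements-< V) t
    ... | a , b , _ , a<k , k≤b , b∈a =
      el a , el b , el-∈ k′ a , elements-< V a<k , elements-≤ V k≤b , ↾-∈⁻ π V b∈a

    down : ∀ i j → Linked π σ (el i) (el j) →
           ∀ k → k ∈ˢ block 1ₙ i → CutsBetween i j k → Bridged (π ↾ V) 1ₙ k
    down i j (_ , x) k _ btw with x (el k) (el-∈ i k) (Sum.map mono mono btw)
      where
      mono : ∀ {u v w} → u <ᶠ v × v ≤ᶠ w → el u <ᶠ el v × el v ≤ᶠ el w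
      mono (s , t) = elements-< V s , elements-≤ V t
    ... | a , b , a∈k , a<k , k≤b , b∈a
      with elements-surjective (∼-trans σ (elements-∈ V k) a∈k)
         | elements-surjective (∼-trans σ (∼-trans σ (elements-∈ V k) a∈k) (≤⇒⊆ π σ π≤σ b∈a))
    ... | a′ , refl | b′ , refl =
      a′ , b′ , lookup-⊤ k a′ , reflects-< (elements-< V) a<k ,
      reflects-≤ (elements-< V) k≤b , ↾-∈⁺ π V b∈a

intervalIn⇒Int-↾ : (ρ σ : NC n) → IntervalIn ρ σ → ∀ l → Int (ρ ↾ block σ l)
intervalIn⇒Int-↾ ρ σ int l i₀ i j k i≤j j≤k i∈ k∈ =
  ↾-∈⁺ ρ V (∼-trans ρ i∈ρ (int (elements-≤ V i≤j) (elements-≤ V j≤k)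
    (∼-trans σ (∼-sym σ (elements-∈ V i)) (elements-∈ V j))
    (∼-trans ρ (∼-sym ρ i∈ρ) (↾-∈⁻ ρ V k∈))))
  where
  V = block σ l
  i∈ρ = ↾-∈⁻ ρ V i∈

Int-↾⇒intervalIn : (ρ σ : NC n) → ρ ≤ σ → (∀ l → Int (ρ ↾ block σ l)) → IntervalIn ρ σ
Int-↾⇒intervalIn ρ σ ρ≤σ int {i} {j} {k} i≤j j≤k j∈i k∈i
  with elements-surjective (∼-refl σ {i}) | elements-surjective j∈i
     | elements-surjective (≤⇒⊆ ρ σ ρ≤σ k∈i)
... | i′ , eqi | j′ , eqj | k′ , eqk = subst₂ R eqi eqj (↾-∈⁻ ρ V (int i i′ i′ j′ k′
    (reflect (subst₂ _≤ᶠ_ (sym eqi) (sym eqj) i≤j))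
    (reflect (subst₂ _≤ᶠ_ (sym eqj) (sym eqk) j≤k))
    (∼-refl (ρ ↾ V)) (↾-∈⁺ ρ V (subst₂ R (sym eqi) (sym eqk) k∈i))))
  where
  V = block σ i
  R : Fin _ → Fin _ → Set
  R i j = j ∈ˢ block ρ i
  reflect : ∀ {u v} → elements V u ≤ᶠ elements V v → u ≤ᶠ v
  reflect = reflects-≤ (elements-< V)

irreducibleOn⇒irreducible-↾ : (π ρ : NC n) → π ≤ ρ → IrreducibleOn π ρ →
                              ∀ l → Irreducible (π ↾ block ρ l)
irreducibleOn⇒irreducible-↾ π ρ π≤ρ irr l i k i<k
  with irr (elements-< V i<k) (∼-trans ρ (∼-sym ρ (elements-∈ V i)) (elements-∈ V k))
  where V = block ρ l
... | a , b , a∈k , a<k , k≤b , b∈a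
  with elements-surjective (∼-trans ρ (elements-∈ (block ρ l) k) a∈k)
     | elements-surjective (∼-trans ρ (∼-trans ρ (elements-∈ (block ρ l) k) a∈k) (≤⇒⊆ π ρ π≤ρ b∈a))
... | a′ , refl | b′ , refl =
  a′ , b′ , reflects-< (elements-< (block ρ l)) a<k ,
  reflects-≤ (elements-< (block ρ l)) k≤b , ↾-∈⁺ π (block ρ l) b∈a

irreducible-↾⇒irreducibleOn : (π ρ : NC n) → (∀ l → Irreducible (π ↾ block ρ l)) →
                              IrreducibleOn π ρ
irreducible-↾⇒irreducibleOn π ρ irr {i} {k} i<k k∈i
  with elements-surjective (∼-refl ρ {i}) | elements-surjective k∈i
... | i′ , eqi | k′ , eqk
  with irr i i′ k′ (reflects-< (elements-< V) (subst₂ _<ᶠ_ (sym eqi) (sym eqk) i<k))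
  where V = block ρ i
... | a , b , a<k , k≤b , b∈a =
  elements V a , elements V b , ∼-trans ρ (∼-sym ρ k∈i) (elements-∈ V a) ,
  subst (elements V a <ᶠ_) eqk (elements-< V a<k) ,
  subst (_≤ᶠ elements V b) eqk (elements-≤ V k≤b) , ↾-∈⁻ π V b∈a
  where V = block ρ i

↾-mono-≤ : (π ρ : NC n) (V : Subset n) → π ≤ ρ → π ↾ V ≤ ρ ↾ V
↾-mono-≤ π ρ V π≤ρ = ⊆⇒≤ (π ↾ V) (ρ ↾ V) (λ x → ↾-∈⁺ ρ V (≤⇒⊆ π ρ π≤ρ (↾-∈⁻ π V x)))

↾-block : (π : NC n) (i : Fin n) → π ↾ block π i ≡ 1ₙ
↾-block π i = NC-ext (π ↾ V) 1ₙ (λ _ → lookup-⊤ _ _)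
  (λ _ → ↾-∈⁺ π V (∼-trans π (∼-sym π (elements-∈ V _)) (elements-∈ V _)))
  where V = block π i

-- Concatenation

join-surjective : ∀ m {n} (i : Fin (m + n)) → ∃[ x ] join m n x ≡ i
join-surjective m i = splitAt m i , Fin.join-splitAt m _ i

↑ˡ-mono : ∀ {m} n → StrictlyMonotone (λ (i : Fin m) → i ↑ˡ n)
↑ˡ-mono n {i} {j} i<j rewrite Fin.toℕ-↑ˡ i n | Fin.toℕ-↑ˡ j n = i<j

↑ʳ-mono : ∀ m {n} → StrictlyMonotone (λ (i : Fin n) → m ↑ʳ i)
↑ʳ-mono m {n} {i} {j} i<j rewrite Fin.toℕ-↑ʳ m i | Fin.toℕ-↑ʳ m j = ℕ.+-monoʳ-< m i<j

↑ˡ<↑ʳ : (i : Fin m) (j : Fin n) → (i ↑ˡ n) <ᶠ (m ↑ʳ j)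
↑ˡ<↑ʳ {m} {n} i j rewrite Fin.toℕ-↑ˡ i n | Fin.toℕ-↑ʳ m j =
  ℕ.<-≤-trans (Fin.toℕ<n i) (ℕ.m≤m+n m _)

module _ (π₁ : NC m) (π₂ : NC n) where
  private module C = Concat (value π₁) (value π₂)

  ⋄-∈⁺ : ∀ x y → C.Same x y → join m n y ∈ˢ block (π₁ ⋄ π₂) (join m n x)
  ⋄-∈⁺ = C.∈-join⁺

  ⋄-∈⁻ : ∀ x y → join m n y ∈ˢ block (π₁ ⋄ π₂) (join m n x) → C.Same x y
  ⋄-∈⁻ = C.∈-join⁻

⋄-mono-≤ : (π₁ ρ₁ : NC m) (π₂ ρ₂ : NC n) → π₁ ≤ ρ₁ → π₂ ≤ ρ₂ → π₁ ⋄ π₂ ≤ ρ₁ ⋄ ρ₂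
⋄-mono-≤ {m} {n} π₁ ρ₁ π₂ ρ₂ le₁ le₂ = ⊆⇒≤ (π₁ ⋄ π₂) (ρ₁ ⋄ ρ₂) (λ {i} {j} → inc i j)
  where
  inc : ∀ i j → j ∈ˢ block (π₁ ⋄ π₂) i → j ∈ˢ block (ρ₁ ⋄ ρ₂) i
  inc i j j∈i with join-surjective m i | join-surjective m j
  ... | x , refl | y , refl = ⋄-∈⁺ ρ₁ ρ₂ x y (go x y (⋄-∈⁻ π₁ π₂ x y j∈i))
    where
    go : ∀ x y → Concat.Same (value π₁) (value π₂) x y → Concat.Same (value ρ₁) (value ρ₂) x y
    go (inj₁ _) (inj₁ _) = ≤⇒⊆ π₁ ρ₁ le₁
    go (inj₂ _) (inj₂ _) = ≤⇒⊆ π₂ ρ₂ le₂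

-- A point between two points of one half lies in the same half.
1⋄1-intervalIn : ∀ m n → IntervalIn (1ₙ {m} ⋄ 1ₙ {n}) 1ₙ
1⋄1-intervalIn m n {i} {j} {k} i≤j j≤k _ k∈i
  with join-surjective m i | join-surjective m j | join-surjective m k
... | x , refl | y , refl | z , refl = ⋄-∈⁺ (1ₙ {m}) (1ₙ {n}) x y
    (go x y z i≤j j≤k (⋄-∈⁻ (1ₙ {m}) (1ₙ {n}) x z k∈i))
  where
  S = Concat.Same (value (1ₙ {m})) (value (1ₙ {n}))
  go : ∀ x y z → join m n x ≤ᶠ join m n y → join m n y ≤ᶠ join m n z → S x z → S x y
  go (inj₁ i) (inj₁ j) _        _   _   _ = lookup-⊤ i j
  go (inj₁ _) (inj₂ j) (inj₁ k) _   j≤k _ = contradiction j≤k (ℕ.<⇒≱ (↑ˡ<↑ʳ k j))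
  go (inj₂ i) (inj₁ j) _        i≤j _   _ = contradiction i≤j (ℕ.<⇒≱ (↑ˡ<↑ʳ j i))
  go (inj₂ i) (inj₂ j) _        _   _   _ = lookup-⊤ i j

components-⋄ : (π₁ : NC m) (π₂ : NC n) →
               components (π₁ ⋄ π₂) 1ₙ ≡ components (π₁ ⋄ π₂) (1ₙ {m} ⋄ 1ₙ {n})
components-⋄ {m} {n} π₁ π₂ = components-interval (π₁ ⋄ π₂) (1ₙ {m} ⋄ 1ₙ {n}) (1ₙ {m + n})
  (⋄-mono-≤ π₁ (1ₙ {m}) π₂ (1ₙ {n}) (≤1ₙ π₁) (≤1ₙ π₂)) (≤1ₙ (1ₙ {m} ⋄ 1ₙ {n})) (1⋄1-intervalIn m n)

module _ (ρ₁ : NC m) (ρ₂ : NC n) where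

  isLeast-⋄ˡ⁺ : ∀ {i} → IsLeast ρ₁ i → IsLeast (ρ₁ ⋄ ρ₂) (i ↑ˡ n)
  isLeast-⋄ˡ⁺ {i} least j j∈i with join-surjective m j
  ... | inj₁ j , refl = mono-≤ (↑ˡ-mono n) (least j (⋄-∈⁻ ρ₁ ρ₂ (inj₁ i) (inj₁ j) j∈i))
  ... | inj₂ j , refl with () ← ⋄-∈⁻ ρ₁ ρ₂ (inj₁ i) (inj₂ j) j∈i

  isLeast-⋄ʳ⁺ : ∀ {i} → IsLeast ρ₂ i → IsLeast (ρ₁ ⋄ ρ₂) (m ↑ʳ i)
  isLeast-⋄ʳ⁺ {i} least j j∈i with join-surjective m j
  ... | inj₂ j , refl = mono-≤ (↑ʳ-mono m) (least j (⋄-∈⁻ ρ₁ ρ₂ (inj₂ i) (inj₂ j) j∈i))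
  ... | inj₁ j , refl with () ← ⋄-∈⁻ ρ₁ ρ₂ (inj₂ i) (inj₁ j) j∈i

  isLeast-⋄ˡ⁻ : ∀ {i} → IsLeast (ρ₁ ⋄ ρ₂) (i ↑ˡ n) → IsLeast ρ₁ i
  isLeast-⋄ˡ⁻ {i} least j j∈i =
    reflects-≤ (↑ˡ-mono n) (least (j ↑ˡ n) (⋄-∈⁺ ρ₁ ρ₂ (inj₁ i) (inj₁ j) j∈i))

  isLeast-⋄ʳ⁻ : ∀ {i} → IsLeast (ρ₁ ⋄ ρ₂) (m ↑ʳ i) → IsLeast ρ₂ i
  isLeast-⋄ʳ⁻ {i} least j j∈i =
    reflects-≤ (↑ʳ-mono m) (least (m ↑ʳ j) (⋄-∈⁺ ρ₁ ρ₂ (inj₂ i) (inj₂ j) j∈i))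

  module _ (π₁ : NC m) (π₂ : NC n) where

    onBlock-⋄ˡ : ∀ i → onBlock (π₁ ⋄ π₂) (ρ₁ ⋄ ρ₂) (i ↑ˡ n) ≡ onBlock π₁ ρ₁ i
    onBlock-⋄ˡ i = sym (toTop-embed {{∣block∣≢0 ρ₁ i}} (π₁ ↾ V) (π₁ ⋄ π₂) (block (ρ₁ ⋄ ρ₂) (i ↑ˡ n))
      {{∣block∣≢0 (ρ₁ ⋄ ρ₂) (i ↑ˡ n)}} {φ = λ j → elements V j ↑ˡ n}
      (λ j<k → ↑ˡ-mono n (elements-< V j<k))
      (λ j → ⋄-∈⁺ ρ₁ ρ₂ (inj₁ i) (inj₁ _) (elements-∈ V j))
      onto
      (λ x → ⋄-∈⁺ π₁ π₂ (inj₁ _) (inj₁ _) (↾-∈⁻ π₁ V x))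
      (λ x → ↾-∈⁺ π₁ V (⋄-∈⁻ π₁ π₂ (inj₁ _) (inj₁ _) x)))
      where
      V = block ρ₁ i
      onto : ∀ {x} → x ∈ˢ block (ρ₁ ⋄ ρ₂) (i ↑ˡ n) → ∃[ j ] elements V j ↑ˡ n ≡ x
      onto {x} x∈ with join-surjective m x
      ... | inj₂ y , refl with () ← ⋄-∈⁻ ρ₁ ρ₂ (inj₁ i) (inj₂ y) x∈
      ... | inj₁ y , refl with elements-surjective (⋄-∈⁻ ρ₁ ρ₂ (inj₁ i) (inj₁ y) x∈)
      ... | j , refl = j , refl

    onBlock-⋄ʳ : ∀ i → onBlock (π₁ ⋄ π₂) (ρ₁ ⋄ ρ₂) (m ↑ʳ i) ≡ onBlock π₂ ρ₂ i
    onBlock-⋄ʳ i = sym (toTop-embed {{∣block∣≢0 ρ₂ i}} (π₂ ↾ V) (π₁ ⋄ π₂) (block (ρ₁ ⋄ ρ₂) (m ↑ʳ i))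
      {{∣block∣≢0 (ρ₁ ⋄ ρ₂) (m ↑ʳ i)}} {φ = λ j → m ↑ʳ elements V j}
      (λ j<k → ↑ʳ-mono m (elements-< V j<k))
      (λ j → ⋄-∈⁺ ρ₁ ρ₂ (inj₂ i) (inj₂ _) (elements-∈ V j))
      onto
      (λ x → ⋄-∈⁺ π₁ π₂ (inj₂ _) (inj₂ _) (↾-∈⁻ π₂ V x))
      (λ x → ↾-∈⁺ π₂ V (⋄-∈⁻ π₁ π₂ (inj₂ _) (inj₂ _) x)))
      where
      V = block ρ₂ i
      onto : ∀ {x} → x ∈ˢ block (ρ₁ ⋄ ρ₂) (m ↑ʳ i) → ∃[ j ] m ↑ʳ elements V j ≡ x
      onto {x} x∈ with join-surjective m x
      ... | inj₁ y , refl with () ← ⋄-∈⁻ ρ₁ ρ₂ (inj₂ i) (inj₁ y) x∈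
      ... | inj₂ y , refl with elements-surjective (⋄-∈⁻ ρ₁ ρ₂ (inj₂ i) (inj₂ y) x∈)
      ... | j , refl = j , refl

-- Indexing by `π₁ ⋄ π₂` lets one match replace the size and the partition together, without
-- transport along an equation of sizes.
data Decomposable : NC n → Set where
  _⋄′_ : .{{_ : NonZero n₁}} .{{_ : NonZero n₂}} (π₁ : NC n₁) (π₂ : NC n₂) → Decomposable (π₁ ⋄ π₂)

decompose : (π : NC (m + n)) → (∀ i j → (m ↑ʳ j) ∉ˢ block π (i ↑ˡ n)) →
            π ≡ pullback (↑ˡ-mono n) π ⋄ pullback (↑ʳ-mono m) π
decompose {m} {n} π cut = NC-ext π (πˡ ⋄ πʳ) (λ {i} {j} → to i j) (λ {i} {j} → from i j)
  where
  πˡ = pullback (↑ˡ-mono n) π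
  πʳ = pullback (↑ʳ-mono m) π
  S = Concat.Same (value πˡ) (value πʳ)

  same : ∀ x y → join m n y ∈ˢ block π (join m n x) → S x y
  same (inj₁ i) (inj₁ j) = ∈-pullback⁺ (↑ˡ-mono n) π
  same (inj₁ i) (inj₂ j) = cut i j
  same (inj₂ i) (inj₁ j) = cut j i ∘ ∼-sym π
  same (inj₂ i) (inj₂ j) = ∈-pullback⁺ (↑ʳ-mono m) π

  same⁻ : ∀ x y → S x y → join m n y ∈ˢ block π (join m n x)
  same⁻ (inj₁ i) (inj₁ j) = ∈-pullback⁻ (↑ˡ-mono n) π
  same⁻ (inj₂ i) (inj₂ j) = ∈-pullback⁻ (↑ʳ-mono m) π

  to : ∀ i j → j ∈ˢ block π i → j ∈ˢ block (πˡ ⋄ πʳ) i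
  to i j j∈i with join-surjective m i | join-surjective m j
  ... | x , refl | y , refl = ⋄-∈⁺ πˡ πʳ x y (same x y j∈i)

  from : ∀ i j → j ∈ˢ block (πˡ ⋄ πʳ) i → j ∈ˢ block π i
  from i j j∈i with join-surjective m i | join-surjective m j
  ... | x , refl | y , refl = same⁻ x y (⋄-∈⁻ πˡ πʳ x y j∈i)

decomposable : ∀ {m p n} (π : NC n) → m + p ≡ n → 0 <ⁿ m → 0 <ⁿ p →
  (∀ a b → toℕ a <ⁿ m → m ≤ⁿ toℕ b → b ∉ˢ block π a) → Decomposable π
decomposable {m} {p} π refl 0<m 0<p cut =
  subst Decomposable (sym (decompose π λ i j → cut (i ↑ˡ p) (m ↑ʳ j) (a<m i) (m≤b j)))
    (_⋄′_ {{>-nonZero 0<m}} {{>-nonZero 0<p}}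
      (pullback (↑ˡ-mono p) π) (pullback (↑ʳ-mono m) π))
  where
  a<m : ∀ i → toℕ (i ↑ˡ p) <ⁿ m
  a<m i rewrite Fin.toℕ-↑ˡ i p = Fin.toℕ<n i
  m≤b : ∀ j → m ≤ⁿ toℕ (m ↑ʳ j)
  m≤b j rewrite Fin.toℕ-↑ʳ m j = ℕ.m≤m+n m _

-- An uncrossed gap before `k` cuts `π` into its first `toℕ k` points and the remaining ones.
reducible⇒decomposable : (π : NC n) → ¬ Irreducible π → Decomposable π
reducible⇒decomposable {n} π ¬irr
  with i , ¬all ← Fin.¬∀⟶∃¬ n _ (λ i → Fin.all? λ k → (i Fin.<? k) →-dec crossed? π k) ¬irr
  with k , ¬cross ← Fin.¬∀⟶∃¬ n _ (λ k → (i Fin.<? k) →-dec crossed? π k) ¬all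
  = decomposable π (ℕ.m+[n∸m]≡n (ℕ.<⇒≤ (Fin.toℕ<n k)))
      -- The left part is non-empty: the failed implication at `k` forces `i <ᶠ k`.
      (ℕ.≤-<-trans z≤n (decidable-stable (i Fin.<? k) λ i≮k → ¬cross λ i<k → contradiction i<k i≮k))
      (ℕ.m<n⇒0<n∸m (Fin.toℕ<n k))
      (λ a b a<k k≤b b∈a → ¬cross λ _ → a , b , a<k , k≤b , b∈a)

-- No block crosses the gap before the first point of `π₂`.
⋄-reducible : .{{_ : NonZero m}} .{{_ : NonZero n}} (π₁ : NC m) (π₂ : NC n) →
              ¬ Irreducible (π₁ ⋄ π₂)
⋄-reducible {suc m} {suc n} π₁ π₂ irr with irr zero (suc m ↑ʳ zero) (↑ˡ<↑ʳ {suc m} zero zero)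
... | a , b , a<k , k≤b , b∈a with join-surjective (suc m) a | join-surjective (suc m) b
... | inj₁ a , refl | inj₁ b , refl = contradiction k≤b (ℕ.<⇒≱ (↑ˡ<↑ʳ b zero))
... | inj₁ a , refl | inj₂ b , refl = ⋄-∈⁻ π₁ π₂ (inj₁ a) (inj₂ b) b∈a
... | inj₂ a , refl | _             = contradiction a<k
  (ℕ.≤⇒≯ (mono-≤ (↑ʳ-mono (suc m)) {zero} {a} z≤n))

-- Representatives of blocks

least-rep : (σ : NC n) (i : Fin n) → ∃[ l ] (IsLeast σ l × i ∈ˢ block σ l)
-- The least point of a block is the smallest counterexample to lying outside it.
least-rep {n} σ i with Fin.¬∀⟶∃¬-smallest n (_∉ˢ block σ i) (λ j → ¬? (j ∈? block σ i))
                         (λ none → none i (∼-refl σ))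
... | l , ¬∉i , smaller = l , least , ∼-sym σ l∈i
  where
  l∈i : l ∈ˢ block σ i
  l∈i = decidable-stable (l ∈? block σ i) ¬∉i
  least : IsLeast σ l
  least j j∈l with l Fin.≤? j
  ... | yes l≤j = l≤j
  ... | no  l≰j = contradiction (∼-trans σ l∈i j∈l)
    (subst (_∉ˢ block σ i) inject-j (smaller (fromℕ< j<l)))
    where
    j<l = ℕ.≰⇒> l≰j
    inject-j : inject (fromℕ< j<l) ≡ j
    inject-j = Fin.toℕ-injective
      (trans (Fin.toℕ-inject (fromℕ< j<l)) (Fin.toℕ-fromℕ< j<l))

least-unique : (σ : NC n) {i l : Fin n} → IsLeast σ i → IsLeast σ l → l ∈ˢ block σ i → i ≡ l
least-unique σ {i} {l} li ll l∈i = Fin.≤-antisym (li l l∈i) (ll i (∼-sym σ l∈i))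

-- As `ρ ≤ σ`, a block of `ρ` that meets a block of `σ` lies inside it, so restriction loses none of
-- its points.
isLeast-↾⁺ : (ρ σ : NC n) → ρ ≤ σ → ∀ l {i} → IsLeast (ρ ↾ block σ l) i →
             IsLeast ρ (elements (block σ l) i)
isLeast-↾⁺ ρ σ ρ≤σ l {i} least k k∈i
  with elements-surjective (∼-trans σ (elements-∈ (block σ l) i) (≤⇒⊆ ρ σ ρ≤σ k∈i))
... | k′ , refl = elements-≤ (block σ l) (least k′ (↾-∈⁺ ρ (block σ l) k∈i))

isLeast-↾⁻ : (ρ : NC n) (V : Subset n) → ∀ {i} → IsLeast ρ (elements V i) → IsLeast (ρ ↾ V) i
isLeast-↾⁻ ρ V least k k∈i = reflects-≤ (elements-< V) (least _ (↾-∈⁻ ρ V k∈i))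

onBlock-↾ : (π ρ σ : NC n) → ρ ≤ σ → ∀ l i →
  onBlock (π ↾ block σ l) (ρ ↾ block σ l) i ≡ onBlock π ρ (elements (block σ l) i)
onBlock-↾ π ρ σ ρ≤σ l i = toTop-↾↾ π V (block ρ (elements V i)) (block (ρ ↾ V) i)
  {{∣block∣≢0 ρ (elements V i)}} {{∣block∣≢0 (ρ ↾ V) i}}
  (λ x∈ → ∼-trans σ (elements-∈ V i) (≤⇒⊆ ρ σ ρ≤σ x∈))
  (↾-∈⁻ ρ V) (↾-∈⁺ ρ V)
  where V = block σ l

1ₙ-irreducible : Irreducible (1ₙ {n})
1ₙ-irreducible i k i<k = i , k , i<k , ℕ.≤-refl , lookup-⊤ i k

-- Enumerations

∈-vectors : {xs : List A} → (∀ x → x ∈ˡ xs) → (v : Vec A n) → v ∈ˡ vectors xs n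
∈-vectors all []      = here refl
∈-vectors all (x ∷ v) = ∈-cartesianProductWith⁺ _∷_ (all x) (∈-vectors all v)

vectors-unique : {xs : List A} → Unique xs → ∀ n → Unique (vectors xs n)
vectors-unique xs! zero    = [] ∷ []
vectors-unique xs! (suc n) = cartesianProductWith⁺ _∷_ ∷-injective xs! (vectors-unique xs! n)

module _ {A : Set a} {P : A → Set b} (P? : Decidable P) where

  ∈-refine : ∀ {x xs} → x ∈ˡ xs → (px : P x) → (x ,ʳ [ px ]) ∈ˡ refine P? xs
  ∈-refine {xs = x ∷ xs} (here refl) px with P? x
  ... | yes _  = here refl
  ... | no ¬px = contradiction px ¬px
  ∈-refine {xs = y ∷ xs} (there x∈xs) px with P? y
  ... | yes _ = there (∈-refine x∈xs px)
  ... | no  _ = ∈-refine x∈xs px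

  All-refine : ∀ {q} {Q : A → Set q} {xs} → All Q xs → All (Q ∘ value) (refine P? xs)
  All-refine []                 = []
  All-refine (_∷_ {x} qx qxs) with P? x
  ... | yes _ = qx ∷ All-refine qxs
  ... | no  _ = All-refine qxs

  refine-unique : ∀ {xs} → Unique xs → Unique (refine P? xs)
  refine-unique []                  = []
  refine-unique (_∷_ {x} x∉xs xs!) with P? x
  ... | yes _ = All.map (λ x≢y → x≢y ∘ cong value) (All-refine x∉xs) ∷ refine-unique xs!
  ... | no  _ = refine-unique xs!

private
  sides : List Side
  sides = inside ∷ outside ∷ []

  ∈-sides : ∀ s → s ∈ˡ sides
  ∈-sides inside  = here refl
  ∈-sides outside = there (here refl)

  sides-unique : Unique sides
  sides-unique = ((λ ()) ∷ []) ∷ [] ∷ []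

∈-between : (π σ : NC n) (ρ : NC n) (πρσ : π ≤ ρ × ρ ≤ σ) → (ρ ,ʳ [ πρσ ]) ∈ˡ between π σ
∈-between π σ ρ πρσ = ∈-refine _ (∈-refine isNonCrossing?
  (∈-vectors (∈-vectors ∈-sides) (value ρ)) (isNonCrossing ρ)) πρσ

-- With `∈-between`, this makes every intermediate partition contribute exactly one term to a
-- convolution, as `∑-single` requires.
between-unique : (π σ : NC n) → Unique (between π σ)
between-unique {n} π σ = refine-unique _ (refine-unique isNonCrossing?
  (vectors-unique (vectors-unique sides-unique n) n))

pair-≡ : .{{_ : NonZero n}} {π ρ ρ′ : NC n} .{p : π ≤ ρ} .{p′ : π ≤ ρ′} → ρ ≡ ρ′ →
         pair π ρ p ≡ pair π ρ′ p′
pair-≡ refl = refl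

module _ {c ℓ} (R : CommutativeRing c ℓ) where
  open Functions R
  private module R = CommutativeRing R
  open R using (Carrier; _≈_; 0#; 1#) renaming (_+_ to _⊕_; _*_ to _⊗_)
  open import Algebra.Properties.CommutativeMonoid.Sum R.*-commutativeMonoid
    using (sum-cong-≋; ∑-comm) renaming (sum to prod)
  open import Relation.Binary.Reasoning.Setoid R.setoid

  -- Finite sums and products in the ring of values.

  resp : (f : Function) {x y : NC²} → x ≡ y → f x ≈ f y
  resp f refl = R.refl

  ∑-zero : (xs : List A) {f : A → Carrier} → All (λ x → f x ≈ 0#) xs → ∑ xs f ≈ 0#
  ∑-zero []       []           = R.refl
  ∑-zero (x ∷ xs) (fx≈0 ∷ f≈0) = R.trans (R.+-cong fx≈0 (∑-zero xs f≈0)) (R.+-identityˡ 0#)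

  ∑-single : {xs : List A} {f : A → Carrier} {x : A} → Unique xs → x ∈ˡ xs →
             (∀ y → x ≢ y → f y ≈ 0#) → ∑ xs f ≈ f x
  ∑-single (x∉xs ∷ _) (here refl) f≈0 =
    R.trans (R.+-congˡ (∑-zero _ (All.map (f≈0 _) x∉xs))) (R.+-identityʳ _)
  ∑-single (y∉xs ∷ xs!) (there x∈xs) f≈0 =
    R.trans (R.+-cong (f≈0 _ λ { refl → All.lookup y∉xs x∈xs refl }) (∑-single xs! x∈xs f≈0))
            (R.+-identityˡ _)

  ∏-zero : {xs : List A} {f : A → Carrier} {x : A} → x ∈ˡ xs → f x ≈ 0# → ∏ xs f ≈ 0#
  ∏-zero (here refl)  fx≈0 = R.trans (R.*-congʳ fx≈0) (R.zeroˡ _)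
  ∏-zero (there x∈xs) fx≈0 = R.trans (R.*-congˡ (∏-zero x∈xs fx≈0)) (R.zeroʳ _)

  -- Factors are indexed by least elements only, but `f` sees just the block, so the value at `i`
  -- reappears at the least element of its block.
  ∏-blocks-zero : (σ : NC n) (f : Subset n → Carrier) (i : Fin n) → f (block σ i) ≈ 0# →
                  ∏ (leastElements σ) (f ∘ block σ) ≈ 0#
  ∏-blocks-zero σ f i fi≈0 with l , least , i∈l ← least-rep σ i =
    ∏-zero (∈-filter⁺ (isLeast? σ) (∈-allFin l) least)
      (R.trans (R.reflexive (cong f (block-≡ σ i∈l))) fi≈0)

  infixr 6 [_]^_
  -- The power of `x` by the Iverson bracket of `A`. It turns a product over some of the points into
  -- one over all of `Fin n`, where factors can be exchanged and reindexed.
  [_]^_ : Dec A → Carrier → Carrier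
  [ A? ]^ x = if does A? then x else 1#

  []^-yes : (A? : Dec A) {x : Carrier} → A → [ A? ]^ x ≈ x
  []^-yes A? a rewrite dec-true A? a = R.refl

  []^-no : (A? : Dec A) {x : Carrier} → ¬ A → [ A? ]^ x ≈ 1#
  []^-no A? ¬a rewrite dec-false A? ¬a = R.refl

  []^-one : (A? : Dec A) {x : Carrier} → (A → x ≈ 1#) → [ A? ]^ x ≈ 1#
  []^-one (yes a) x≈1 = x≈1 a
  []^-one (no _)  x≈1 = R.refl

  []^-cong : {A : Set a} {B : Set b} (A? : Dec A) (B? : Dec B) {x y : Carrier} →
             (A → B) → (B → A) → (A → x ≈ y) → [ A? ]^ x ≈ [ B? ]^ y
  []^-cong (yes a) B? to from x≈y = R.trans (x≈y a) (R.sym ([]^-yes B? (to a)))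
  []^-cong (no ¬a) B? to from x≈y = R.sym ([]^-no B? (¬a ∘ from))

  prod-one : {f : Fin n → Carrier} → (∀ i → f i ≈ 1#) → prod f ≈ 1#
  prod-one {zero}  f≈1 = R.refl
  prod-one {suc n} f≈1 = R.trans (R.*-cong (f≈1 zero) (prod-one (f≈1 ∘ suc))) (R.*-identityˡ 1#)

  prod-single : {f : Fin n → Carrier} (k : Fin n) → (∀ i → i ≢ k → f i ≈ 1#) → prod f ≈ f k
  prod-single zero    f≈1 =
    R.trans (R.*-congˡ (prod-one λ i → f≈1 (suc i) λ ())) (R.*-identityʳ _)
  prod-single (suc k) f≈1 = R.trans
    (R.*-cong (f≈1 zero λ ()) (prod-single k λ i i≢k → f≈1 (suc i) (i≢k ∘ Fin.suc-injective)))
    (R.*-identityˡ _)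

  prod-++ : ∀ m {n} (f : Fin (m + n) → Carrier) →
            prod f ≈ prod (λ i → f (i ↑ˡ n)) ⊗ prod (λ i → f (m ↑ʳ i))
  prod-++ zero    f = R.sym (R.*-identityˡ _)
  prod-++ (suc m) f = R.trans (R.*-congˡ (prod-++ m (f ∘ suc))) (R.sym (R.*-assoc _ _ _))

  []^-prod : (A? : Dec A) (f : Fin n → Carrier) → [ A? ]^ prod f ≈ prod (λ i → [ A? ]^ f i)
  []^-prod (yes _) f = R.refl
  []^-prod {n = n} (no _) f = R.sym (prod-one {n} {f = λ _ → 1#} λ _ → R.refl)

  prod-elements : (V : Subset n) (f : Fin n → Carrier) →
                  prod (f ∘ elements V) ≈ prod (λ k → [ k ∈? V ]^ f k)
  prod-elements []            f = R.refl
  prod-elements (inside  ∷ V) f = R.*-congˡ (prod-elements V (f ∘ suc))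
  prod-elements (outside ∷ V) f =
    R.trans (prod-elements V (f ∘ suc)) (R.sym (R.*-identityˡ _))

  ∏-filter : (P? : Decidable P) (t : Fin n → A) (f : A → Carrier) →
             ∏ (filter P? (tabulateˡ t)) f ≈ prod (λ i → [ P? (t i) ]^ f (t i))
  ∏-filter {n = zero}  P? t f = R.refl
  ∏-filter {n = suc n} P? t f with P? (t zero)
  ... | yes _ = R.*-congˡ (∏-filter P? (t ∘ suc) f)
  ... | no  _ = R.trans (∏-filter P? (t ∘ suc) f) (R.sym (R.*-identityˡ _))

  ∏-leastElements : (σ : NC n) (f : Fin n → Carrier) →
                    ∏ (leastElements σ) f ≈ prod (λ i → [ isLeast? σ i ]^ f i)
  ∏-leastElements σ f = ∏-filter (isLeast? σ) id f

  -- After exchanging the two products, each `k` meets exactly one least element `i` with `k` in the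
  -- block of `i`, so `f k` occurs once.
  prod-blocks : (σ : NC n) (f : Fin n → Carrier) →
                ∏ (leastElements σ) (λ i → prod (f ∘ elements (block σ i))) ≈ prod f
  prod-blocks σ f = begin
    ∏ (leastElements σ) (λ i → prod (f ∘ elements (block σ i)))
      ≈⟨ ∏-leastElements σ _ ⟩
    prod (λ i → [ isLeast? σ i ]^ prod (f ∘ elements (block σ i)))
      ≈⟨ sum-cong-≋ (λ i → R.trans
           ([]^-cong (isLeast? σ i) (isLeast? σ i) id id λ _ → prod-elements (block σ i) f)
           ([]^-prod (isLeast? σ i) λ k → [ k ∈? block σ i ]^ f k)) ⟩
    prod (λ i → prod (λ k → [ isLeast? σ i ]^ [ k ∈? block σ i ]^ f k))
      ≈⟨ ∑-comm (λ i k → [ isLeast? σ i ]^ [ k ∈? block σ i ]^ f k) ⟩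
    prod (λ k → prod (λ i → [ isLeast? σ i ]^ [ k ∈? block σ i ]^ f k))
      ≈⟨ sum-cong-≋ onlyLeast ⟩
    prod f ∎
    where
    onlyLeast : ∀ k → prod (λ i → [ isLeast? σ i ]^ [ k ∈? block σ i ]^ f k) ≈ f k
    onlyLeast k with l , l-least , k∈l ← least-rep σ k = R.trans
      (prod-single l λ i i≢l → other i i≢l)
      (R.trans ([]^-yes (isLeast? σ l) l-least) ([]^-yes (k ∈? block σ l) k∈l))
      where
      other : ∀ i → i ≢ l → [ isLeast? σ i ]^ [ k ∈? block σ i ]^ f k ≈ 1#
      other i i≢l = []^-one (isLeast? σ i) λ i-least → []^-no (k ∈? block σ i) λ k∈i →
        i≢l (least-unique σ i-least l-least (∼-trans σ k∈i (∼-sym σ k∈l)))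

  -- Consequences of multiplicativity.

  multiplicative-prod : {k : Function} → G̃ k → .{{_ : NonZero n}} (π ρ : NC n) .(π≤ρ : π ≤ ρ) →
    k (pair π ρ π≤ρ) ≈ prod (λ i → [ isLeast? ρ i ]^ k (onBlock π ρ i))
  multiplicative-prod k∈G̃ π ρ π≤ρ =
    R.trans (G̃.multiplicative k∈G̃ π ρ π≤ρ) (∏-leastElements ρ _)

  -- Every block of `ρ` lies in one block of `σ`. With its factor placed at its least element,
  -- `prod-blocks` groups the factors by the blocks of `σ`.
  multiplicative-↾ : {k : Function} → G̃ k → .{{_ : NonZero n}} (π ρ σ : NC n)
    (π≤ρ : π ≤ ρ) (ρ≤σ : ρ ≤ σ) →
    k (pair π ρ π≤ρ) ≈ ∏ (leastElements σ) λ l →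
      k (pair {{∣block∣≢0 σ l}} (π ↾ block σ l) (ρ ↾ block σ l) (↾-mono-≤ π ρ (block σ l) π≤ρ))
  multiplicative-↾ {k = k} k∈G̃ π ρ σ π≤ρ ρ≤σ = begin
    k (pair π ρ π≤ρ)
      ≈⟨ multiplicative-prod k∈G̃ π ρ π≤ρ ⟩
    prod f
      ≈⟨ prod-blocks σ f ⟨
    ∏ (leastElements σ) (λ l → prod (f ∘ elements (block σ l)))
      ≈⟨ ∏-cong (leastElements σ) (λ l → sum-cong-≋ λ i →
           []^-cong (isLeast? ρ _) (isLeast? (ρ ↾ block σ l) i)
             (isLeast-↾⁻ ρ (block σ l)) (isLeast-↾⁺ ρ σ ρ≤σ l)
             (λ _ → R.sym (resp k (onBlock-↾ π ρ σ ρ≤σ l i)))) ⟩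
    ∏ (leastElements σ) (λ l → prod λ i →
      [ isLeast? (ρ ↾ block σ l) i ]^ k (onBlock (π ↾ block σ l) (ρ ↾ block σ l) i))
      ≈⟨ ∏-cong (leastElements σ) (λ l →
           multiplicative-prod k∈G̃ {{∣block∣≢0 σ l}} (π ↾ block σ l) (ρ ↾ block σ l)
             (↾-mono-≤ π ρ (block σ l) π≤ρ)) ⟨
    ∏ (leastElements σ) (λ l → k (pair {{∣block∣≢0 σ l}} (π ↾ block σ l) (ρ ↾ block σ l)
      (↾-mono-≤ π ρ (block σ l) π≤ρ))) ∎
    where
    f : Fin _ → Carrier
    f i = [ isLeast? ρ i ]^ k (onBlock π ρ i)

  -- The blocks of `ρ₁ ⋄ ρ₂` are those of `ρ₁` and shifted copies of those of `ρ₂`, so the product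
  -- over points splits after the first `m` of them.
  multiplicative-⋄ : {k : Function} → G̃ k → .{{_ : NonZero m}} .{{_ : NonZero n}}
    (π₁ ρ₁ : NC m) (π₂ ρ₂ : NC n) (le₁ : π₁ ≤ ρ₁) (le₂ : π₂ ≤ ρ₂) →
    k (pair {{+-nonZero m n}} (π₁ ⋄ π₂) (ρ₁ ⋄ ρ₂) (⋄-mono-≤ π₁ ρ₁ π₂ ρ₂ le₁ le₂)) ≈
    k (pair π₁ ρ₁ le₁) ⊗ k (pair π₂ ρ₂ le₂)
  multiplicative-⋄ {m} {n} {k} k∈G̃ π₁ ρ₁ π₂ ρ₂ le₁ le₂ = begin
    k (pair {{+-nonZero m n}} (π₁ ⋄ π₂) (ρ₁ ⋄ ρ₂) _)
      ≈⟨ multiplicative-prod k∈G̃ {{+-nonZero m n}} (π₁ ⋄ π₂) (ρ₁ ⋄ ρ₂)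
           (⋄-mono-≤ π₁ ρ₁ π₂ ρ₂ le₁ le₂) ⟩
    prod (λ i → [ isLeast? (ρ₁ ⋄ ρ₂) i ]^ k (onBlock (π₁ ⋄ π₂) (ρ₁ ⋄ ρ₂) i))
      ≈⟨ prod-++ m _ ⟩
    prod (λ i → [ isLeast? (ρ₁ ⋄ ρ₂) (i ↑ˡ n) ]^ k (onBlock (π₁ ⋄ π₂) (ρ₁ ⋄ ρ₂) (i ↑ˡ n))) ⊗
    prod (λ i → [ isLeast? (ρ₁ ⋄ ρ₂) (m ↑ʳ i) ]^ k (onBlock (π₁ ⋄ π₂) (ρ₁ ⋄ ρ₂) (m ↑ʳ i)))
      ≈⟨ R.*-cong
           (sum-cong-≋ λ i → []^-cong (isLeast? (ρ₁ ⋄ ρ₂) (i ↑ˡ n)) (isLeast? ρ₁ i)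
             (isLeast-⋄ˡ⁻ ρ₁ ρ₂) (isLeast-⋄ˡ⁺ ρ₁ ρ₂)
             (λ _ → resp k (onBlock-⋄ˡ ρ₁ ρ₂ π₁ π₂ i)))
           (sum-cong-≋ λ i → []^-cong (isLeast? (ρ₁ ⋄ ρ₂) (m ↑ʳ i)) (isLeast? ρ₂ i)
             (isLeast-⋄ʳ⁻ ρ₁ ρ₂) (isLeast-⋄ʳ⁺ ρ₁ ρ₂)
             (λ _ → resp k (onBlock-⋄ʳ ρ₁ ρ₂ π₁ π₂ i))) ⟩
    prod (λ i → [ isLeast? ρ₁ i ]^ k (onBlock π₁ ρ₁ i)) ⊗
    prod (λ i → [ isLeast? ρ₂ i ]^ k (onBlock π₂ ρ₂ i))
      ≈⟨ R.*-cong (multiplicative-prod k∈G̃ π₁ ρ₁ le₁) (multiplicative-prod k∈G̃ π₂ ρ₂ le₂) ⟨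
    k (pair π₁ ρ₁ le₁) ⊗ k (pair π₂ ρ₂ le₂) ∎

  G̃-ext : {h k : Function} → G̃ h → G̃ k →
           (∀ {n} .{{_ : NonZero n}} (π : NC n) → h (toTop π) ≈ k (toTop π)) → h ≋ k
  G̃-ext {h} {k} h∈G̃ k∈G̃ eq (pair π σ π≤σ) = begin
    h (pair π σ π≤σ)  ≈⟨ G̃.multiplicative h∈G̃ π σ π≤σ ⟩
    ∏-blocks π σ h    ≈⟨ ∏-cong (leastElements σ) (λ i → eq {{∣block∣≢0 σ i}} (π ↾ block σ i)) ⟩
    ∏-blocks π σ k    ≈⟨ G̃.multiplicative k∈G̃ π σ π≤σ ⟨
    k (pair π σ π≤σ)  ∎

  G̃-cm-resp : {h k : Function} → h ≋ k → G̃-cm k → G̃-cm h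
  G̃-cm-resp {h} {k} h≋k (k∈G̃ , k-cm) =
    record
      { unit           = λ π → R.trans (h≋k _) (G̃.unit k∈G̃ π)
      ; multiplicative = λ π σ π≤σ → R.trans (h≋k _) (R.trans (G̃.multiplicative k∈G̃ π σ π≤σ)
          (∏-cong (leastElements σ) λ i → R.sym (h≋k _))) } ,
    λ π₁ π₂ → R.trans (h≋k _) (R.trans (k-cm π₁ π₂) (R.sym (R.*-cong (h≋k _) (h≋k _))))

  -- Evaluation at the irreducible components.

  atComponents : Function → Function
  atComponents k (pair π σ π≤σ) = k (pair π (components π σ) (≤components π σ π≤σ))

  module _ {k : Function} (k∈G̃ : G̃ k) where

    atComponents-G̃ : G̃ (atComponents k)
    atComponents-G̃ = record
      { unit           = λ π → R.trans (resp k (pair-≡ (components-refl π))) (G̃.unit k∈G̃ π)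
      -- The order proof in a pair is irrelevant; decidability of the order yields one that
      -- `components-↾` can use.
      ; multiplicative = λ π σ π≤σ → mult π σ (recompute (π ≤? σ) π≤σ) }
      where
      mult : ∀ {n} .{{_ : NonZero n}} (π σ : NC n) (π≤σ : π ≤ σ) →
             atComponents k (pair π σ π≤σ) ≈ ∏-blocks π σ (atComponents k)
      mult π σ π≤σ = R.trans
        (multiplicative-↾ k∈G̃ π (components π σ) σ (≤components π σ π≤σ) (components≤ π σ))
        (∏-cong (leastElements σ) λ l →
          R.sym (resp k (pair-≡ {{∣block∣≢0 σ l}} (components-↾ π σ π≤σ l))))

    atComponents-cm : CumulantToMoment (atComponents k)
    atComponents-cm {n₁} {n₂} π₁ π₂ = R.trans
      (resp k (pair-≡ {{+-nonZero n₁ n₂}} (components-⋄ π₁ π₂)))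
      -- The value is read as that of `atComponents k` at the pair of `π₁ ⋄ π₂` and `1ₙ ⋄ 1ₙ`, so
      -- the multiplicativity applied is that of `atComponents k`.
      (multiplicative-⋄ atComponents-G̃ π₁ 1ₙ π₂ 1ₙ (≤1ₙ π₁) (≤1ₙ π₂))

  -- For irreducible `π` the partition `1ₙ` meets the characterisation in `components-unique`, so it
  -- is the partition into components.
  atComponents-irreducible : (k : Function) .{{_ : NonZero n}} (π : NC n) → Irreducible π →
                             atComponents k (toTop π) ≈ k (toTop π)
  atComponents-irreducible k π irr = resp k (pair-≡ (sym
    (components-unique π 1ₙ 1ₙ (≤1ₙ π) (λ _ _ _ _ → lookup-⊤ _ _) (≤-refl 1ₙ)
      λ {i} {l} i<l _ → let a , b , rest = irr i l i<l in a , b , lookup-⊤ l a , rest)))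

  -- By `G̃-ext` only the pairs below `1ₙ` matter. Strong induction on the size then applies: a
  -- reducible partition is a concatenation of smaller ones, over which both sides factor.
  atComponents-fixes-cm : {h : Function} → G̃-cm h → atComponents h ≋ h
  atComponents-fixes-cm {h} (h∈G̃ , h-cm) =
    G̃-ext (atComponents-G̃ h∈G̃) h∈G̃ (λ {n} π → go π (ℕ.<-wellFounded n))
    where
    ĥ = atComponents h
    go : ∀ {n} .{{_ : NonZero n}} (π : NC n) → Acc _<ⁿ_ n → ĥ (toTop π) ≈ h (toTop π)
    split : ∀ {n} .{{_ : NonZero n}} {π : NC n} → (∀ {m} → m <ⁿ n → Acc _<ⁿ_ m) →
            Decomposable π → ĥ (toTop π) ≈ h (toTop π)

    go π (acc rs) = case irreducible? π of λ where
      (yes irr) → atComponents-irreducible h π irr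
      (no ¬irr) → split rs (reducible⇒decomposable π ¬irr)

    split rs (_⋄′_ {n₁} {n₂} π₁ π₂) = begin
      ĥ (toTop {{+-nonZero n₁ n₂}} (π₁ ⋄ π₂)) ≈⟨ atComponents-cm h∈G̃ π₁ π₂ ⟩
      ĥ (toTop π₁) ⊗ ĥ (toTop π₂)  ≈⟨ R.*-cong (go π₁ (rs (ℕ.m<m+n n₁ (>-nonZero⁻¹ n₂))))
                                                (go π₂ (rs (ℕ.m<n+m n₂ (>-nonZero⁻¹ n₁)))) ⟩
      h (toTop π₁) ⊗ h (toTop π₂)  ≈⟨ h-cm π₁ π₂ ⟨
      h (toTop {{+-nonZero n₁ n₂}} (π₁ ⋄ π₂))  ∎

  -- Convolution with `g-bc-m`.

  cc-decomposable : {g : Function} → CumulantToCumulant g → .{{_ : NonZero n}} {π : NC n} →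
                    Decomposable π → g (toTop π) ≈ 0#
  cc-decomposable g-cc (_⋄′_ {{n₁≢0}} {{n₂≢0}} π₁ π₂) = g-cc {{n₁≢0}} {{n₂≢0}} π₁ π₂

  g-bc-m-zero : .{{_ : NonZero n}} (ρ σ : NC n) .(ρ≤σ : ρ ≤ σ) →
                ¬ (∀ i → Int (ρ ↾ block σ i)) → g-bc-m (pair ρ σ ρ≤σ) ≈ 0#
  g-bc-m-zero {n} ρ σ _ ¬int =
    let i , ¬intᵢ = Fin.¬∀⟶∃¬ n _ (λ i → Int? (ρ ↾ block σ i)) ¬int in
    ∏-blocks-zero σ (λ V → intIndicator (ρ ↾ V)) i (intIndicator-no (ρ ↾ block σ i) ¬intᵢ)

  -- A block of `ρ` on which `π` is reducible carries a concatenation, where `g` is zero.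
  -- Reducibility is moved from `i` to the least element `l` of its block, since only least elements
  -- index factors.
  cc-zero : {g : Function} → G̃-cc g → .{{_ : NonZero n}} (π ρ : NC n) .(π≤ρ : π ≤ ρ) →
            ¬ (∀ i → Irreducible (π ↾ block ρ i)) → g (pair π ρ π≤ρ) ≈ 0#
  cc-zero {n} {g} (g∈G̃ , g-cc) π ρ π≤ρ ¬irr =
    let i , ¬irrᵢ = Fin.¬∀⟶∃¬ n _ (λ i → irreducible? (π ↾ block ρ i)) ¬irr
        l , least , i∈l = least-rep ρ i
    in R.trans (G̃.multiplicative g∈G̃ π ρ π≤ρ)
         (∏-zero (∈-filter⁺ (isLeast? ρ) (∈-allFin l) least)
           (cc-decomposable {g = g} g-cc {{∣block∣≢0 ρ l}}
             (reducible⇒decomposable (π ↾ block ρ l)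
               (¬irrᵢ ∘ subst (λ V → Irreducible (π ↾ V)) (block-≡ ρ i∈l)))))

  -- Of the ρ ∈ [π , σ] with g-bc-m (ρ , σ) ≠ 0, only components π σ has no
  -- block on which π is reducible.
  ⋆g-bc-m : {g : Function} → G̃-cc g → g ⋆ g-bc-m ≋ atComponents g
  ⋆g-bc-m {g} g∈cc (pair {n} π σ π≤σ′) = R.trans
    (∑-single {x = κ ,ʳ [ π≤κ , κ≤σ ]} (between-unique π σ) (∈-between π σ κ (π≤κ , κ≤σ))
      λ { (ρ ,ʳ [ πρσ ]) κ≢ρ → vanishes ρ (recompute (π ≤? ρ) (proj₁ πρσ))
            (recompute (ρ ≤? σ) (proj₂ πρσ)) λ { refl → κ≢ρ refl } })
    -- In the surviving term the factor of `g-bc-m` is `1#`, because `κ` is an interval partition on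
    -- each block of `σ`.
    (R.trans (R.*-congˡ (∏-1 (leastElements σ) λ i → intIndicator-yes (κ ↾ block σ i)
               (intervalIn⇒Int-↾ κ σ (components-intervalIn π σ) i)))
             (R.*-identityʳ _))
    where
    π≤σ = recompute (π ≤? σ) π≤σ′
    κ = components π σ
    π≤κ = ≤components π σ π≤σ
    κ≤σ = components≤ π σ
    vanishes : ∀ ρ (π≤ρ : π ≤ ρ) (ρ≤σ : ρ ≤ σ) → ρ ≢ κ →
               g (pair π ρ π≤ρ) ⊗ g-bc-m (pair ρ σ ρ≤σ) ≈ 0#
    vanishes ρ π≤ρ ρ≤σ ρ≢κ =
      case Fin.all? (λ i → Int? (ρ ↾ block σ i)) ,′
           Fin.all? (λ i → irreducible? (π ↾ block ρ i)) of λ where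
        (no ¬int , _)       → R.trans (R.*-congˡ (g-bc-m-zero ρ σ ρ≤σ ¬int)) (R.zeroʳ _)
        (yes _ , no ¬irr)   → R.trans (R.*-congʳ (cc-zero g∈cc π ρ π≤ρ ¬irr)) (R.zeroˡ _)
        (yes int , yes irr) → contradiction
          (components-unique π ρ σ π≤ρ (Int-↾⇒intervalIn ρ σ ρ≤σ int) ρ≤σ
            (irreducible-↾⇒irreducibleOn π ρ irr)) ρ≢κ

  -- Recovering a cumulant-to-cumulant function.

  multiplicativeExtension : Function → Function
  multiplicativeExtension f (pair π σ _) = ∏-blocks π σ f

  multiplicativeExtension-toTop : (f : Function) .{{_ : NonZero n}} (π : NC n) →
    multiplicativeExtension f (toTop π) ≈ f (toTop π)
  multiplicativeExtension-toTop {suc n} f π rewrite leastElements-1ₙ n =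
    R.trans (R.*-identityʳ _) (resp f (toTop-↾⊤ π))

  -- A partition restricted to one of its own blocks is `1ₙ`, so the unit law reduces to the value
  -- of `f` there.
  multiplicativeExtension-G̃ : (f : Function) →
    (∀ {n} .{{_ : NonZero n}} → f (toTop (1ₙ {n})) ≈ 1#) → G̃ (multiplicativeExtension f)
  multiplicativeExtension-G̃ f f-1ₙ = record
    { unit           = λ π → ∏-1 (leastElements π) λ i → R.trans
        (R.reflexive (cong (λ ρ → f (toTop {{∣block∣≢0 π i}} ρ)) (↾-block π i)))
        (f-1ₙ {{∣block∣≢0 π i}})
    ; multiplicative = λ π σ _ → ∏-cong (leastElements σ) λ i →
        R.sym (multiplicativeExtension-toTop f {{∣block∣≢0 σ i}} (π ↾ block σ i)) }

  -- The upper partition is ignored because `multiplicativeExtension` reads only pairs with top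
  -- `1ₙ`. The default `0#` is what makes the extension vanish on concatenations.
  onIrreducibles : Function → Function
  onIrreducibles h (pair π _ _) = if does (irreducible? π) then h (toTop π) else 0#

  onIrreducibles-yes : (h : Function) .{{_ : NonZero n}} (π : NC n) → Irreducible π →
                       onIrreducibles h (toTop π) ≈ h (toTop π)
  onIrreducibles-yes h π irr rewrite dec-true (irreducible? π) irr = R.refl

  onIrreducibles-no : (h : Function) .{{_ : NonZero n}} (π : NC n) → ¬ Irreducible π →
                      onIrreducibles h (toTop π) ≈ 0#
  onIrreducibles-no h π ¬irr rewrite dec-false (irreducible? π) ¬irr = R.refl

  module _ {h : Function} (h∈G̃ : G̃ h) where

    irreduciblePart : Function
    irreduciblePart = multiplicativeExtension (onIrreducibles h)

    irreduciblePart-cc : G̃-cc irreduciblePart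
    irreduciblePart-cc =
      multiplicativeExtension-G̃ (onIrreducibles h)
        (λ {n} → R.trans (onIrreducibles-yes h 1ₙ 1ₙ-irreducible) (G̃.unit h∈G̃ 1ₙ)) ,
      λ {n₁} {n₂} π₁ π₂ → R.trans
        (multiplicativeExtension-toTop (onIrreducibles h) {{+-nonZero n₁ n₂}} (π₁ ⋄ π₂))
        (onIrreducibles-no h {{+-nonZero n₁ n₂}} (π₁ ⋄ π₂) (⋄-reducible π₁ π₂))

    -- On every block of the components `π` is irreducible, so all factors are values of `h` itself.
    atComponents-irreduciblePart : atComponents irreduciblePart ≋ atComponents h
    atComponents-irreduciblePart (pair π σ π≤σ) = R.trans
      (∏-cong (leastElements κ) λ i →
        onIrreducibles-yes h {{∣block∣≢0 κ i}} (π ↾ block κ i)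
          (irreducibleOn⇒irreducible-↾ π κ (≤components π σ (recompute (π ≤? σ) π≤σ))
            (components-irreducibleOn π σ) i))
      (R.sym (G̃.multiplicative h∈G̃ π κ (≤components π σ π≤σ)))
      where κ = components π σ

proposition8p4 : ∀ {c ℓ} (R : CommutativeRing c ℓ) → let open Functions R in
    G̃-cm ≐ (λ h → ∃[ g ] (g ∈ G̃-cc × h ≋ g ⋆ g-bc-m))
proposition8p4 R =
  -- The witness has the same values at components as `h`, and those values already determine `h`,
  -- by `atComponents-fixes-cm`.
  (λ {h} h∈cm@(h∈G̃ , _) → irreduciblePart R h∈G̃ , irreduciblePart-cc R h∈G̃ , λ x →
    R.sym (R.trans (⋆g-bc-m R (irreduciblePart-cc R h∈G̃) x)
          (R.trans (atComponents-irreduciblePart R h∈G̃ x) (atComponents-fixes-cm R h∈cm x)))) ,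
  (λ {h} (g , g∈cc@(g∈G̃ , _) , h≋) →
    G̃-cm-resp R (λ x → R.trans (h≋ x) (⋆g-bc-m R g∈cc x))
      (atComponents-G̃ R g∈G̃ , atComponents-cm R g∈G̃))
  where module R = CommutativeRing R
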